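{- Let $G$ be a $5$-connected graph. If $P$ and $Q$ are any two longest paths in $G$, then $|V(P)\cap V(Q)|\ge 5$.
   Context: All graphs are finite and simple. A graph is $k$-connected if it has more than $k$ vertices and remains connected after deleting any set of fewer than $k$ vertices. The length of a path is its number of edges, and a longest path in $G$ is a path of maximum length among all paths in $G$. $V(P)$ denotes the vertex set of $P$. -}

module Defs where

open import Data.Fin using (Fin)
open import Data.Fin.Subset using (Subset; ⁅_⁆; ⋃; _∉_; ∣_∣)
open import Data.List using (List; _∷_; length; map)
open import Data.List.Relation.Unary.Linked using (Linked)
open import Data.List.Relation.Unary.Unique.Propositional using (Unique)
open import Data.Nat using (ℕ; _≤_; _<_)
open import Data.Product using (∃; _×_; proj₁)
open import Function using (_on_)
open import Level using (0ℓ)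
open import Relation.Binary using (Rel; Symmetric; Irreflexive; Decidable)
open import Relation.Binary.Construct.Closure.ReflexiveTransitive using (Star)
open import Relation.Binary.PropositionalEquality using (_≡_)

-- Finite simple graphs with vertex set Fin n.  Decidability of adjacency makes
-- the edge set a finite set in the constructive sense too.
record Graph (n : ℕ) : Set₁ where
  field
    _~_      : Rel (Fin n) 0ℓ
    ~-sym    : Symmetric _~_
    ~-irrefl : Irreflexive _≡_ _~_
    _~?_     : Decidable _~_

-- Any two vertices are joined by a walk.  An empty vertex type counts as
-- connected; this case cannot arise in IsConnected below, where fewer than k
-- of more than k vertices are deleted.
Connected : {V : Set} → Rel V 0ℓ → Set
Connected R = ∀ u v → Star R u v

-- Adjacency of the subgraph induced on the vertices outside S.
_−_ : ∀ {n} → Graph n → (S : Subset n) → Rel (∃ λ v → v ∉ S) 0ℓ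
G − S = Graph._~_ G on proj₁

IsConnected : ∀ {n} → ℕ → Graph n → Set
IsConnected {n} k G = k < n × (∀ (S : Subset n) → ∣ S ∣ < k → Connected (G − S))

record Path {n : ℕ} (G : Graph n) : Set where
  field
    start : Fin n
    rest  : List (Fin n)

  vertices : List (Fin n)
  vertices = start ∷ rest

  field
    distinct : Unique vertices
    linked   : Linked (Graph._~_ G) vertices

-- The number of edges: each vertex after the first contributes one.
pathLength : ∀ {n} {G : Graph n} → Path G → ℕ
pathLength P = length (Path.rest P)

V⟨_⟩ : ∀ {n} {G : Graph n} → Path G → Subset n
V⟨ P ⟩ = ⋃ (map ⁅_⁆ (Path.vertices P))

IsLongest : ∀ {n} {G : Graph n} → Path G → Set
IsLongest {G = G} P = ∀ (R : Path G) → pathLength R ≤ pathLength P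

{-# OPTIONS --safe #-}
module Submission where

-- Joining an apex to every vertex turns the two paths into longest cycles C and D
-- that meet in at most five vertices if P and Q share at most four.  Deleting the
-- common vertices leaves the graph connected, so some path R joins C to D off the
-- common vertices.  C ∪ D ∪ R is a subdivision of a small multigraph determined by
-- the order σ in which D visits the common vertices of C.  For all but fourteen σ
-- there are two cycles through R that together cover C and D exactly once, so one
-- of them is longer than C.  The fourteen exceptions form three classes under
-- exchanging and reversing C and D.  In these some segment of C has an interior
-- vertex, since otherwise other cycles again beat C and D.  By connectivity a
-- second path leaves the interior of this segment or of the parallel segment of D,
-- and wherever it lands, two or three cycles (counted against copies of C and D)
-- give the contradiction.  The finitely many cases are decided by evaluation.

open import Defs
open import Data.Fin.Subset using (_∩_; ∣_∣)
open import Data.Nat using (ℕ; _≥_)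

open import Data.Bool using (Bool; true; false; if_then_else_; not; _∧_)
open import Data.Bool.ListAction using (any)
import Data.Bool.Properties as Bool
open import Data.Empty using (⊥; ⊥-elim)
open import Data.Fin using (Fin; zero; suc; toℕ; fromℕ<; _↑ˡ_; _↑ʳ_; splitAt)
import Data.Fin.Properties as Fin
open import Data.Fin.Subset as Subset using (Subset; ⁅_⁆; ⋃; inside; ⊤; _-_)
import Data.Fin.Subset.Properties as Subset
open import Data.List using (List; []; _∷_; _++_; length; map; reverse; concat; concatMap; replicate; tabulate; cartesianProduct; filterᵇ)
open import Data.List.Membership.Propositional using (_∈_; _∉_; find)
open import Data.List.Membership.Propositional.Properties using (∈-∃++; ∈-++⁺ˡ; ∈-++⁺ʳ; ∈-++⁻; ∈-map⁺; ∈-map⁻)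
import Data.List.Membership.DecPropositional as DecMembership
open import Data.List.Properties using (length-++; length-map; length-reverse; unfold-reverse; map-++; map-∘; map-tabulate; tabulate-cong)
open import Data.List.Relation.Binary.Disjoint.Propositional using (Disjoint)
open import Data.List.Relation.Binary.Permutation.Propositional using (_↭_; ↭-refl; ↭-sym; ↭-trans; ↭-prep; ↭-swap; ↭⇒↭ₛ)
open import Data.List.Relation.Binary.Permutation.Propositional.Properties using (↭-reverse; ↭-length; ∈-resp-↭; map⁺; ++-comm)
import Data.List.Relation.Binary.Permutation.Setoid.Properties as Permutation
open import Data.List.Relation.Unary.All as All using (All; []; _∷_)
open import Data.List.Relation.Unary.All.Properties using (¬Any⇒All¬; ¬All⇒Any¬)
open import Data.List.Relation.Unary.AllPairs using ([]; _∷_; tail)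
open import Data.List.Relation.Unary.Any using (here; there)
open import Data.List.Relation.Unary.Any.Properties using (reverse⁻)
open import Data.List.Relation.Unary.Linked using (Linked; [-]; _∷_)
open import Data.List.Relation.Unary.Unique.Propositional using (Unique)
open import Data.List.Relation.Unary.Unique.Propositional.Properties as Unique using (++⁺; Unique[x∷xs]⇒x∉xs)
import Data.List.Relation.Unary.Unique.DecPropositional as DecUnique
open import Data.Maybe using (Maybe; just; nothing; is-just; _>>=_; _<∣>_)
open import Data.Nat using (zero; suc; _+_; _*_; _∸_; _%_; _/_; _≤_; _<_; z≤n; s≤s; _≤?_; _<?_; _≡ᵇ_; _<ᵇ_)
open import Data.Nat.ListAction using (sum)
open import Data.Nat.ListAction.Properties using (sum-++; sum-↭)
import Data.Nat.Properties as ℕ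
open import Data.Product using (∃; Σ-syntax; _×_; _,_; proj₁; proj₂)
open import Data.Sum using (_⊎_; inj₁; inj₂; [_,_]′)
import Data.Sum.Properties as Sum
open import Data.Unit using (tt) renaming (⊤ to Unit)
open import Data.Vec as Vec using (Vec; []; _∷_; _∷ʳ_; lookup; allFin; toList) renaming (_++_ to _++ⱽ_)
open import Data.Vec.Properties using (lookup-map; lookup-++ˡ; lookup-++ʳ; map-∷ʳ; map-lookup-allFin) renaming (map-∘ to mapⱽ-∘)
open import Function using (_∘_; case_of_)
open import Level using (0ℓ)
open import Relation.Binary using (Rel; Symmetric; DecidableEquality)
open import Relation.Binary.Construct.Closure.ReflexiveTransitive as Star using (Star; ε; _◅_)
open import Relation.Binary.PropositionalEquality hiding ([_])
open import Relation.Nullary using (¬_; Dec; yes; no; contradiction)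
open import Relation.Unary using (Pred; Decidable)

private variable
  A : Set
  m k l n : ℕ

-- Duplicate-free lists and weighted sums.

unique-∷ : ∀ {A : Set} {x : A} {xs} → x ∉ xs → Unique xs → Unique (x ∷ xs)
unique-∷ {xs = xs} x∉xs u = ¬Any⇒All¬ xs x∉xs ∷ u

unique-↭ : ∀ {A : Set} {xs ys : List A} → xs ↭ ys → Unique xs → Unique ys
unique-↭ p = Permutation.Unique-resp-↭ (setoid _) (↭⇒↭ₛ p)

unique-++⁻ : ∀ {A : Set} (xs : List A) {ys} → Unique (xs ++ ys) →
             Unique xs × Unique ys × Disjoint xs ys
unique-++⁻ []       u = [] , u , λ { (() , _) }
unique-++⁻ (x ∷ xs) u@(_ ∷ u′) with unique-++⁻ xs u′
... | uxs , uys , dis =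
  unique-∷ (x∉ ∘ ∈-++⁺ˡ) uxs , uys ,
  λ { (here refl , v∈ys) → x∉ (∈-++⁺ʳ xs v∈ys) ; (there v∈xs , v∈ys) → dis (v∈xs , v∈ys) }
  where x∉ = Unique[x∷xs]⇒x∉xs u

sum-map-++ : ∀ {A : Set} (w : A → ℕ) xs ys → sum (map w (xs ++ ys)) ≡ sum (map w xs) + sum (map w ys)
sum-map-++ w xs ys = trans (cong sum (map-++ w xs ys)) (sum-++ (map w xs) (map w ys))

-- Walks, loop erasure and bridges between vertex sets.

module Chains {V : Set} (_~_ : Rel V 0ℓ) where

  Chain : V → List V → V → Set
  Chain u []       w = u ~ w
  Chain u (x ∷ xs) w = u ~ x × Chain x xs w

  chain-++ : ∀ {u v w} xs {ys} → Chain u xs v → Chain v ys w → Chain u (xs ++ v ∷ ys) w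
  chain-++ []       u~v       d = u~v , d
  chain-++ (x ∷ xs) (u~x , c) d = u~x , chain-++ xs c d

  chain-split : ∀ {u v w} xs {ys} → Chain u (xs ++ v ∷ ys) w → Chain u xs v × Chain v ys w
  chain-split []       (u~v , d) = u~v , d
  chain-split (x ∷ xs) (u~x , c) with chain-split xs c
  ... | c₁ , c₂ = (u~x , c₁) , c₂

  chain-reverse : Symmetric _~_ → ∀ {u w} xs → Chain u xs w → Chain w (reverse xs) u
  chain-reverse ~-sym []       u~w       = ~-sym u~w
  chain-reverse ~-sym (x ∷ xs) (u~x , c) rewrite unfold-reverse x xs =
    chain-++ (reverse xs) (chain-reverse ~-sym xs c) (~-sym u~x)

  -- Loop erasure: if the next vertex occurs again in the shortened remainder, the stretch between
  -- the two occurrences is dropped.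
  shortcut : DecidableEquality V → ∀ {u w} xs → Chain u xs w →
             Σ[ ys ∈ List V ] Chain u ys w × Unique ys × (∀ {x} → x ∈ ys → x ∈ xs)
  shortcut _≟_ []       u~w       = [] , u~w , [] , λ ()
  shortcut _≟_ (x ∷ xs) (u~x , c) with shortcut _≟_ xs c
  ... | ys , d , uys , ys⊆ with DecMembership._∈?_ _≟_ x ys
  ...   | no  x∉ys = x ∷ ys , (u~x , d) , unique-∷ x∉ys uys ,
                     λ { (here eq) → here eq ; (there i) → there (ys⊆ i) }
  ...   | yes x∈ys with ∈-∃++ x∈ys
  ...     | as , bs , refl =
    x ∷ bs , (u~x , proj₂ (chain-split as d)) , proj₁ (proj₂ (unique-++⁻ as uys)) ,
    λ { (here eq) → here eq ; (there i) → there (ys⊆ (∈-++⁺ʳ as (there i))) }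

  module _ (_≟_ : DecidableEquality V) {Y U T F : V → Set}
           (classify : ∀ v → Y v → U v ⊎ T v ⊎ F v) (U∩T=∅ : ∀ {v} → U v → T v → ⊥) where

    Bridge : Set
    Bridge = ∃ λ u → ∃ λ t → Σ[ xs ∈ List V ]
             U u × T t × Chain u xs t × Unique xs × (∀ {x} → x ∈ xs → F x)

    private
      Tail : V → Set
      Tail a = ∃ λ t → T t × (a ≡ t ⊎ (Σ[ xs ∈ List V ] Chain a xs t × All F xs))

      toBridge : ∀ {u t} xs → U u → T t → Chain u xs t → All F xs → Bridge
      toBridge {u} {t} xs Uu Tt c Fxs with shortcut _≟_ xs c
      ... | ys , d , uys , ys⊆ = u , t , ys , Uu , Tt , d , uys , All.lookup Fxs ∘ ys⊆

      -- The walk is read from its end, keeping a piece that leads from the current vertex through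
      -- `F` to a vertex of `T`. Each further vertex of `T` restarts the piece, and the first vertex
      -- of `U` completes a bridge.
      scan : ∀ {a w} → T w → Star (λ a b → a ~ b × Y b) a w → Bridge ⊎ Tail a
      scan Tw ε = inj₂ (_ , Tw , inj₁ refl)
      scan Tw (_◅_ {j = b} (a~b , Yb) walk) with scan Tw walk
      ... | inj₁ bridge                   = inj₁ bridge
      ... | inj₂ (t , Tt , inj₁ refl)     = inj₂ (t , Tt , inj₂ ([] , a~b , []))
      ... | inj₂ (t , Tt , inj₂ (xs , c , Fxs)) with classify b Yb
      ...   | inj₁ Ub        = inj₁ (toBridge xs Ub Tt c Fxs)
      ...   | inj₂ (inj₁ Tb) = inj₂ (b , Tb , inj₂ ([] , a~b , []))
      ...   | inj₂ (inj₂ Fb) = inj₂ (t , Tt , inj₂ (b ∷ xs , (a~b , c) , Fb ∷ Fxs))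

    bridge : ∀ {u w} → U u → T w → Star (λ a b → a ~ b × Y b) u w → Bridge
    bridge Uu Tw walk with scan Tw walk
    ... | inj₁ b                              = b
    ... | inj₂ (t , Tt , inj₁ refl)           = contradiction Tt (U∩T=∅ Uu)
    ... | inj₂ (t , Tt , inj₂ (xs , c , Fxs)) = toBridge xs Uu Tt c Fxs

-- Skeletons and their circuits

Node : ℕ → ℕ → Set
Node m k = Fin m ⊎ Fin k

Part : ℕ → ℕ → ℕ → Set
Part m k n = Node m k ⊎ Fin n

pattern anchor i  = inj₁ i
pattern free j    = inj₂ j
pattern nodeAt ν  = inj₁ ν
pattern segment e = inj₂ e

_≟ᴺ_ : ∀ {m k} → DecidableEquality (Node m k)
_≟ᴺ_ = Sum.≡-dec Fin._≟_ Fin._≟_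

_≟ᴾ_ : ∀ {m k n} → DecidableEquality (Part m k n)
_≟ᴾ_ = Sum.≡-dec _≟ᴺ_ Fin._≟_

-- The anchors are the common vertices of the two cycles, which are listed by the
-- segments they consist of.
record Skeleton (m k n : ℕ) : Set where
  field
    source target : Fin n → Node m k
    cycle₁ cycle₂ : List (Fin n)

open Skeleton

data Step (S : Skeleton m k n) : Node m k → Node m k → Set where
  forth : ∀ e → Step S (source S e) (target S e)
  back  : ∀ e → Step S (target S e) (source S e)

infixr 5 _∷_

data Route (S : Skeleton m k n) : Node m k → Node m k → Set where
  [_] : ∀ {ν μ} → Step S ν μ → Route S ν μ
  _∷_ : ∀ {ν μ κ} → Step S ν μ → Route S μ κ → Route S ν κ

edge : ∀ {S : Skeleton m k n} {ν μ} → Step S ν μ → Fin n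
edge (forth e) = e
edge (back e)  = e

edges : ∀ {S : Skeleton m k n} {ν μ} → Route S ν μ → List (Fin n)
edges [ s ]   = edge s ∷ []
edges (s ∷ r) = edge s ∷ edges r

parts : ∀ {S : Skeleton m k n} {ν μ} → Route S ν μ → List (Part m k n)
parts [ s ]           = segment (edge s) ∷ []
parts (_∷_ {μ = μ} s r) = segment (edge s) ∷ nodeAt μ ∷ parts r

-- Segments have to be distinct as well as nodes, since otherwise running one segment forth and back
-- would count as a circuit.
record Circuit (S : Skeleton m k n) : Set where
  field
    base   : Node m k
    route  : Route S base base
    simple : Unique (nodeAt base ∷ parts route)

  circuitEdges : List (Fin n)
  circuitEdges = edges route

open Circuit

module _ (S : Skeleton m k n) where

  step? : ∀ ν e → Maybe (∃ (Step S ν))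
  step? ν e with source S e ≟ᴺ ν | target S e ≟ᴺ ν
  ... | yes refl | _        = just (_ , forth e)
  ... | no _     | yes refl = just (_ , back e)
  ... | no _     | no _     = nothing

  route? : ∀ ν (e : Fin n) (es : List (Fin n)) → Maybe (∃ (Route S ν))
  route? ν e [] = do
    μ , s ← step? ν e
    just (μ , [ s ])
  route? ν e (f ∷ es) = do
    μ , s ← step? ν e
    κ , r ← route? μ f es
    just (κ , s ∷ r)

  circuitFrom? : ∀ ν (e : Fin n) (es : List (Fin n)) → Maybe (Circuit S)
  circuitFrom? ν e es = do
    κ , r ← route? ν e es
    yes refl ← just (κ ≟ᴺ ν) where no _ → nothing
    yes u ← just (DecUnique.unique? _≟ᴾ_ (nodeAt ν ∷ parts r)) where no _ → nothing
    just record { base = ν ; route = r ; simple = u }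

  -- Certificates list segments without directions. Once the base is known the directions follow,
  -- and the base is one of the two ends of the first segment.
  circuit? : List (Fin n) → Maybe (Circuit S)
  circuit? []       = nothing
  circuit? (e ∷ es) = circuitFrom? (source S e) e es <∣> circuitFrom? (target S e) e es

  circuits? : List (List (Fin n)) → Maybe (List (Circuit S))
  circuits? []         = just []
  circuits? (es ∷ ess) = do
    c  ← circuit? es
    cs ← circuits? ess
    just (c ∷ cs)

-- Comparing weights of families of segments.

-- With w the length of a segment and Z a set of segments known to be single edges,
-- the segments es outweigh ts as soon as rest has more than d members.
Balance : List (Fin n) → List (Fin n) → List (Fin n) → Set
Balance {n} Z es ts = Σ[ d ∈ ℕ ] Σ[ rest ∈ List (Fin n) ]
  (∀ (w : Fin n → ℕ) → (∀ {z} → z ∈ Z → w z ≡ 1) →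
   sum (map w es) + d ≡ sum (map w ts) + sum (map w rest))

remove : (t : Fin n) (es : List (Fin n)) → Maybe (∃ λ fs → es ↭ t ∷ fs)
remove t []       = nothing
remove t (e ∷ es) with t Fin.≟ e
... | yes refl = just (es , ↭-refl)
... | no _     = do
  fs , p ← remove t es
  just (e ∷ fs , ↭-trans (↭-prep e p) (↭-swap e t ↭-refl))

balance : (Z ts es : List (Fin n)) → Maybe (Balance Z es ts)
balance Z []       es = just (0 , es , λ w _ → ℕ.+-identityʳ _)
balance Z (t ∷ ts) es with DecMembership._∈?_ Fin._≟_ t Z
-- A segment of weight one is paid for by the constant `d`, so it may be missing from `es`.
... | yes t∈Z = do
  d , rest , eq ← balance Z ts es
  just (suc d , rest , λ w unit → begin
    sum (map w es) + suc d                  ≡⟨ ℕ.+-suc _ d ⟩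
    suc (sum (map w es) + d)                ≡⟨ cong₂ _+_ (sym (unit t∈Z)) (eq w unit) ⟩
    w t + (sum (map w ts) + sum (map w rest)) ≡⟨ ℕ.+-assoc (w t) _ _ ⟨
    sum (map w (t ∷ ts)) + sum (map w rest) ∎)
  where open ≡-Reasoning
... | no _ = do
  fs , p ← remove t es
  d , rest , eq ← balance Z ts fs
  just (d , rest , λ w unit → begin
    sum (map w es) + d                      ≡⟨ cong (_+ d) (sum-↭ (map⁺ w p)) ⟩
    w t + sum (map w fs) + d                ≡⟨ ℕ.+-assoc (w t) _ d ⟩
    w t + (sum (map w fs) + d)              ≡⟨ cong (w t +_) (eq w unit) ⟩
    w t + (sum (map w ts) + sum (map w rest)) ≡⟨ ℕ.+-assoc (w t) _ _ ⟨
    sum (map w (t ∷ ts)) + sum (map w rest) ∎)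
  where open ≡-Reasoning

copies : ℕ → List (Fin n) → List (Fin n)
copies a es = concat (replicate a es)

sum-copies : ∀ (w : Fin n → ℕ) a es → sum (map w (copies a es)) ≡ a * sum (map w es)
sum-copies w zero    es = refl
sum-copies w (suc a) es = trans (sum-map-++ w es (copies a es)) (cong (sum (map w es) +_) (sum-copies w a es))

length≤sum : ∀ (w : Fin n → ℕ) → (∀ e → 1 ≤ w e) → ∀ es → length es ≤ sum (map w es)
length≤sum w 1≤w []       = z≤n
length≤sum w 1≤w (e ∷ es) = ℕ.+-mono-≤ (1≤w e) (length≤sum w 1≤w es)

-- Subdividing segments and attaching paths.

raise : Node m k → Node m (suc k)
raise (anchor i) = anchor i
raise (free j)   = free (suc j)

-- The decision is an argument so that one case distinction on `f Fin.≟ e` later reduces both the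
-- target and the interior of a subdivided segment.
cut : ∀ {f e : Fin n} → Node m k → Dec (f ≡ e) → Node m (suc k)
cut ν (yes _) = free zero
cut ν (no _)  = raise ν

halves : Fin n → List (Fin n) → List (Fin (suc n))
halves e []       = []
halves e (f ∷ fs) with f Fin.≟ e
... | yes _ = suc f ∷ zero ∷ halves e fs
... | no _  = suc f ∷ halves e fs

-- The first half of e keeps its name up to the shift; the new node and the second
-- half are called zero.
split : Skeleton m k n → Fin n → Skeleton m (suc k) (suc n)
split S e = record
  { source = λ { zero → free zero         ; (suc f) → raise (source S f) }
  ; target = λ { zero → raise (target S e) ; (suc f) → cut (target S f) (f Fin.≟ e) }
  ; cycle₁ = halves e (cycle₁ S)
  ; cycle₂ = halves e (cycle₂ S)
  }

attach : Skeleton m k n → Node m k → Node m k → Skeleton m k (suc n)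
attach S ν μ = record
  { source = λ { zero → ν ; (suc f) → source S f }
  ; target = λ { zero → μ ; (suc f) → target S f }
  ; cycle₁ = map suc (cycle₁ S)
  ; cycle₂ = map suc (cycle₂ S)
  }

-- The later subdivision takes the name `free zero`, so the node on `e` has become `free (suc zero)`
-- and the attached path runs from `e` to `f`.
segmentChild : Skeleton m k n → Fin n → Fin n → Skeleton m (suc (suc k)) (suc (suc (suc n)))
segmentChild S e f = attach (split (split S e) (suc f)) (free (suc zero)) (free zero)

nodeChild : Skeleton m k n → Fin n → Fin k → Skeleton m (suc k) (suc (suc n))
nodeChild S e j = attach (split S e) (free zero) (free (suc j))

-- Both cycles are cut open at the ends p and q of the connecting path.  Segment 0 is
-- that path, 1, …, m + 1 follow the first cycle from p through the anchors in order,
-- and m + 2, …, 2 m + 2 follow the second one from q through the anchors ordered by σ.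
tieUp : ∀ {m} → Vec (Fin m) m → Skeleton m 2 (1 + (suc m + suc m))
tieUp {m} σ = record
  { source = lookup (p ∷ (p ∷ anchors) ++ⱽ (q ∷ Vec.map anchor σ))
  ; target = lookup (q ∷ (anchors ∷ʳ p) ++ⱽ (Vec.map anchor σ ∷ʳ q))
  ; cycle₁ = tabulate λ (i : Fin (suc m)) → suc (i ↑ˡ suc m)
  ; cycle₂ = tabulate λ (i : Fin (suc m)) → suc (suc m ↑ʳ i)
  }
  where
  anchors : Vec (Node m 2) m
  anchors = Vec.map anchor (allFin m)
  p q : Node m 2
  p = free zero
  q = free (suc zero)

-- Searching for two complementary circuits.

_∈ᵇ_ : ℕ → List ℕ → Bool
x ∈ᵇ xs = any (x ≡ᵇ_) xs

-- Nothing is proved about the search: its result is checked by certify.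
module Search {m : ℕ} (σ : Vec (Fin m) m) where

  label : ℕ → ℕ → List ℕ → ℕ → List (ℕ × ℕ × ℕ)
  label i u []       w = (i , u , w) ∷ []
  label i u (x ∷ xs) w = (i , u , x) ∷ label (suc i) x xs w

  graph : List (ℕ × ℕ × ℕ)
  graph = label 1 m (map toℕ (toList (allFin m))) m
       ++ label (2 + m) (suc m) (map toℕ (toList σ)) (suc m)

  paths : ℕ → ℕ → List ℕ → List (List ℕ)
  paths zero    u seen = if u ≡ᵇ m then [] ∷ [] else []
  paths (suc l) u seen = concatMap continue graph
    where
    visit : ℕ → ℕ → List (List ℕ)
    visit i w = if w ∈ᵇ seen then [] else map (i ∷_) (paths l w (w ∷ seen))
    continue : ℕ × ℕ × ℕ → List (List ℕ)
    continue (i , s , t) = if s ≡ᵇ u then visit i t else if t ≡ᵇ u then visit i s else []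

  -- With the anchors numbered below `m`, node p is `m` and node q is `suc m`. Going from q to p in
  -- `m + 1` steps without repetition visits all `m + 2` nodes.
  hamiltonian : List (List ℕ)
  hamiltonian = paths (suc m) (suc m) (suc m ∷ [])

  -- Each Hamiltonian path uses `m + 1` of the `2 m + 2` segments of the two cycles, so two disjoint
  -- ones use them all. Segment 0 closes both to circuits, and it is the surplus over the two
  -- cycles.
  complementary : List (List ℕ) → List (List ℕ)
  complementary []       = []
  complementary (c ∷ cs) with filterᵇ (λ d → not (any (_∈ᵇ c) d)) hamiltonian
  ... | []    = complementary cs
  ... | d ∷ _ = (0 ∷ c) ∷ (0 ∷ d) ∷ []

  -- One circuit is charged to each cycle. A failed search leaves no circuits, and `certify` then
  -- rejects the 1.
  pairing : ℕ × List (List ℕ)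
  pairing = 1 , complementary hamiltonian

-- A plan treats one of the three exceptional classes, with segments numbered as in
-- tieUp; the new segments after inserting a second path are numbered from 2 m + 3
-- upwards in the order: second half of the segment it leaves, second half of the
-- segment it lands on (if any), the path itself.  A circuit is a hexadecimal numeral
-- whose digits are its segments, the first one least significant.  An entry deals
-- with a path from segment from to segment to, where 2 m + 3 and 2 m + 4 stand for
-- the nodes p and q; copies₁ of the circuits are charged to the first cycle and the
-- others to the second.  The certificate stretch shows that inner, a member of
-- region, is longer than an edge.
record Entry : Set where
  constructor entry
  field
    from to copies₁ : ℕ
    circuits        : List ℕ

record Plan : Set where
  field
    region  : List ℕ
    inner   : ℕ
    stretch : ℕ × List ℕ
    table   : List Entry

-- σ = 1 0 3 2
fourFold : Plan
fourFold = record
  { region = 2 ∷ 7 ∷ []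
  ; inner  = 2
  ; stretch = 1 , 0x810639 ∷ 0x45176A ∷ []
  ; table  =
    entry 2 0 1 (0xB34810D ∷ 0x276A950D ∷ []) ∷
    entry 2 1 1 (0x106398C ∷ 0xB789A01D ∷ 0x276A451D ∷ []) ∷
    entry 2 3 1 (0xB7159CD ∷ 0x284A63D ∷ []) ∷
    entry 2 4 1 (0x210639CD ∷ 0xB7850A4D ∷ []) ∷
    entry 2 5 1 (0x2106395D ∷ 0xB784A0CD ∷ []) ∷
    entry 2 6 2 (0xB398106D ∷ 0x2734506D ∷ 0x6A4512BC ∷ []) ∷
    entry 2 8 1 (0xB39518D ∷ 0x276A4CD ∷ []) ∷
    entry 2 9 1 (0xB710A49D ∷ 0x285063CD ∷ []) ∷
    entry 2 10 2 (0xB39810CD ∷ 0x273450CD ∷ 0xA4512B6C ∷ []) ∷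
    entry 2 11 1 (0x810639 ∷ 0xB789A0C ∷ 0x276A45C ∷ []) ∷
    entry 2 12 2 (0xB39810C ∷ 0x273450C ∷ 0x2154A6B ∷ []) ∷
    entry 7 0 1 (0x734810D ∷ 0xB26A950D ∷ []) ∷
    entry 7 1 1 (0x7289A01D ∷ 0xB893601D ∷ 0x154A67BC ∷ []) ∷
    entry 7 3 1 (0xB159A63D ∷ 0x7284CD ∷ []) ∷
    entry 7 4 1 (0x7601894D ∷ 0xB23A05CD ∷ []) ∷
    entry 7 5 1 (0xB106395D ∷ 0x7284A0CD ∷ []) ∷
    entry 7 6 2 (0x601893C ∷ 0xB234506D ∷ 0x72154A6D ∷ []) ∷
    entry 7 8 1 (0x76A9518D ∷ 0xB234CD ∷ []) ∷
    entry 7 9 1 (0x73A0189D ∷ 0xB26054CD ∷ []) ∷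
    entry 7 10 2 (0x739810CD ∷ 0xB23450CD ∷ 0xA45126C ∷ []) ∷
    entry 7 11 1 (0x7289A0C ∷ 0xB89360C ∷ 0x76A451B ∷ []) ∷
    entry 7 12 2 (0x810639 ∷ 0xB23450C ∷ 0x72154AC ∷ []) ∷
    []
  }

-- σ = 1 0 4 3 2
fiveFold : Plan
fiveFold = record
  { region = 2 ∷ 8 ∷ []
  ; inner  = 2
  ; stretch = 1 , 0xA91073B ∷ 0x456187C ∷ []
  ; table  =
    entry 2 0 1 (0xD3BA910F ∷ 0x287C4560F ∷ []) ∷
    entry 2 1 1 (0x1073BA9E ∷ 0xD89ABC01F ∷ 0x287C4561F ∷ []) ∷
    entry 2 3 1 (0xD816ABEF ∷ 0x2954C73F ∷ []) ∷
    entry 2 4 1 (0xD3C019AEF ∷ 0x287065B4F ∷ []) ∷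
    entry 2 5 1 (0x21073BAEF ∷ 0xD8960C45F ∷ []) ∷
    entry 2 6 1 (0x21073BA6F ∷ 0xD8954C0EF ∷ []) ∷
    entry 2 7 2 (0xD3BA9107F ∷ 0x28345607F ∷ 0x7C45612DE ∷ []) ∷
    entry 2 9 1 (0xD3BA619F ∷ 0x287C45EF ∷ []) ∷
    entry 2 10 1 (0xD810CB5AF ∷ 0x2960734EF ∷ []) ∷
    entry 2 11 1 (0xD7019A4EF ∷ 0x283C065BF ∷ []) ∷
    entry 2 12 2 (0xD3BA910EF ∷ 0x2834560EF ∷ 0xC45612D7E ∷ []) ∷
    entry 2 13 1 (0xA91073B ∷ 0xD89ABC0E ∷ 0x287C456E ∷ []) ∷
    entry 2 14 2 (0xD3BA910E ∷ 0x2834560E ∷ 0x21654C7D ∷ []) ∷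
    entry 8 0 1 (0x83BA910F ∷ 0xD27C4560F ∷ []) ∷
    entry 8 1 1 (0x829ABC01F ∷ 0xD9AB3701F ∷ 0x1654C78DE ∷ []) ∷
    entry 8 3 1 (0xD16ABC73F ∷ 0x82954EF ∷ []) ∷
    entry 8 4 1 (0x87019AB4F ∷ 0xD23C065EF ∷ []) ∷
    entry 8 5 1 (0xD1073BAEF ∷ 0x82960C45F ∷ []) ∷
    entry 8 6 1 (0xD1073BA6F ∷ 0x82954C0EF ∷ []) ∷
    entry 8 7 2 (0x7019AB3E ∷ 0xD2345607F ∷ 0x821654C7F ∷ []) ∷
    entry 8 9 1 (0x87CBA619F ∷ 0xD2345EF ∷ []) ∷
    entry 8 10 1 (0xD1073B5AF ∷ 0x82960C4EF ∷ []) ∷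
    entry 8 11 1 (0x87019A4EF ∷ 0xD23C065BF ∷ []) ∷
    entry 8 12 2 (0x83BA910EF ∷ 0xD234560EF ∷ 0xC456127E ∷ []) ∷
    entry 8 13 1 (0x829ABC0E ∷ 0xD9AB370E ∷ 0x87C4561D ∷ []) ∷
    entry 8 14 2 (0xA91073B ∷ 0xD234560E ∷ 0x821654CE ∷ []) ∷
    []
  }

-- σ = 1 0 3 4 2
twisted : Plan
twisted = record
  { region = 5 ∷ 10 ∷ []
  ; inner  = 5
  ; stretch = 2 , 0x389A60C ∷ 0x607894B ∷ 0x6123B ∷ 0x4A6127C ∷ []
  ; table  =
    entry 5 0 1 (0xDA43810F ∷ 0x5927CB60F ∷ []) ∷
    entry 5 1 1 (0xDB498701F ∷ 0x5A60C32EF ∷ []) ∷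
    entry 5 2 1 (0x5AB37012F ∷ 0xD60C498EF ∷ []) ∷
    entry 5 3 1 (0xDA4C0123F ∷ 0x598706BEF ∷ []) ∷
    entry 5 4 1 (0x5A6187C4F ∷ 0xDB329EF ∷ []) ∷
    entry 5 6 1 (0x6A983C0E ∷ 0xDB49870EF ∷ 0x5ABC721EF ∷ []) ∷
    entry 5 7 2 (0xDA438107F ∷ 0x5923B607F ∷ 0x7C45D612E ∷ []) ∷
    entry 5 8 1 (0xDB491078F ∷ 0x5A60C32EF ∷ []) ∷
    entry 5 9 1 (0xD6187C4EF ∷ 0x5AB329F ∷ []) ∷
    entry 5 11 1 (0x54C7816BF ∷ 0xDA923EF ∷ []) ∷
    entry 5 12 2 (0xDA43810EF ∷ 0xC3295D60E ∷ 0x54B6127EF ∷ []) ∷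
    entry 5 13 1 (0x329A60C ∷ 0xDB49870E ∷ 0x5ABC781E ∷ []) ∷
    entry 5 14 2 (0xDA43210E ∷ 0x5923C06D ∷ 0x54B6187E ∷ []) ∷
    entry 10 0 2 (0xD543810F ∷ 0xE065923C ∷ 0xA4B6127EF ∷ []) ∷
    entry 10 1 1 (0xDB498701F ∷ 0xA560C32EF ∷ []) ∷
    entry 10 2 1 (0xA5BC018EF ∷ 0xD6073492F ∷ []) ∷
    entry 10 3 1 (0xA5BC0183F ∷ 0xD607294EF ∷ []) ∷
    entry 10 4 1 (0xA56187C4F ∷ 0xDB329EF ∷ []) ∷
    entry 10 6 1 (0x6DA983C0E ∷ 0xDB49870EF ∷ 0xA5BC721EF ∷ []) ∷
    entry 10 7 1 (0xA5B38107F ∷ 0xD60C492EF ∷ []) ∷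
    entry 10 8 1 (0xA5B3701EF ∷ 0xD60C4928F ∷ []) ∷
    entry 10 9 1 (0xD6187C4EF ∷ 0xA5B329F ∷ []) ∷
    entry 10 11 1 (0xA43816BF ∷ 0xD5927CEF ∷ []) ∷
    entry 10 12 2 (0xD543810EF ∷ 0xC329560E ∷ 0xA4B6127EF ∷ []) ∷
    entry 10 13 1 (0xA983C06D ∷ 0xDB49870E ∷ 0xA5BC721E ∷ []) ∷
    entry 10 14 2 (0xD543810E ∷ 0x329560C ∷ 0xA4B6127E ∷ []) ∷
    []
  }


-- Transporting plans along symmetries.

digits : ℕ → ℕ → List ℕ
digits zero       _ = []
-- A leading zero digit would be lost here, so no stored circuit lists segment 0 last.
digits (suc fuel) 0 = []
digits (suc fuel) x = x % 16 ∷ digits fuel (x / 16)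

-- Transports plans along the exchange of the two cycles and the reversal of either.
-- A reversed segment exchanges its halves when it is subdivided.
module Symmetry (m : ℕ) (swap flip₁ flip₂ : Bool) where

  size : ℕ
  size = suc (suc m + suc m)

  side : Bool → ℕ → ℕ → ℕ
  side flip start i = start + (if flip then m ∸ i else i)

  image : ℕ → ℕ
  image 0 = 0
  image (suc i) = if i <ᵇ suc m
    then side flip₁ (if swap then 2 + m else 1) i
    else side flip₂ (if swap then 1 else 2 + m) (i ∸ suc m)

  -- The connecting path is directed from the first cycle to the second, so exchanging the cycles
  -- reverses it.
  flipped : ℕ → Bool
  flipped 0       = swap
  flipped (suc i) = if i <ᵇ suc m then flip₁ else flip₂

  -- The codes `size` and `suc size` stand for p and q, which trade places when the cycles do.
  imageEnd : ℕ → ℕ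
  imageEnd t = if t <ᵇ size then image t else if swap then 2 * size + 1 ∸ t else t

  imageHalf : (from to : ℕ) → ℕ → ℕ
  imageHalf e t i =
    if i <ᵇ size then
      (if (i ≡ᵇ e) ∧ flipped e then size
       else if (i ≡ᵇ t) ∧ flipped t then suc size
       else image i)
    else if (i ≡ᵇ size) ∧ flipped e then image e
    -- If the path lands on a node, `suc size` is the path itself and not a half of a segment.
    else if (i ≡ᵇ suc size) ∧ (t <ᵇ size) ∧ flipped t then image t
    else i

  imageCertificate : (ℕ → ℕ) → ℕ × List ℕ → ℕ × List (List ℕ)
  imageCertificate f (a , cs) =
    -- The circuits charged to the second cycle are now charged to the first.
    (if swap then length cs ∸ a else a) , map (map f ∘ digits 16) cs

  lookupEntry : List Entry → ℕ → ℕ → ℕ × List (List ℕ)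
  -- The default is a certificate that `certify` rejects, because nothing is left over to make the
  -- inequality strict.
  lookupEntry []                        e t = 0 , []
  lookupEntry (entry e′ t′ a cs ∷ table) e t =
    if (image e′ ≡ᵇ e) ∧ (imageEnd t′ ≡ᵇ t)
    then imageCertificate (imageHalf e′ t′) (a , cs)
    else lookupEntry table e t

-- Exhaustive checks that return proofs.

all-fin? : ∀ {n} {P : Fin n → Set} → (∀ i → Maybe (P i)) → Maybe (∀ i → P i)
all-fin? {zero}  P? = just λ ()
all-fin? {suc n} P? = do
  p₀ ← P? zero
  p₊ ← all-fin? (P? ∘ suc)
  just λ { zero → p₀ ; (suc i) → p₊ i }

all-vec? : ∀ {n l} {P : Vec (Fin n) l → Set} → (∀ v → Maybe (P v)) → Maybe (∀ v → P v)
all-vec? {l = zero}  P? = do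
  p ← P? []
  just λ { [] → p }
all-vec? {l = suc l} P? = do
  p ← all-fin? (λ i → all-vec? (λ v → P? (i ∷ v)))
  just λ { (i ∷ v) → p i v }

toFin : ∀ n → ℕ → Maybe (Fin n)
toFin n i = do
  yes i<n ← just (i <? n) where no _ → nothing
  just (fromℕ< i<n)

toFins : ∀ n → List ℕ → Maybe (List (Fin n))
toFins n []       = just []
toFins n (i ∷ is) = do
  j  ← toFin n i
  js ← toFins n is
  just (j ∷ js)

toCircuits : ∀ n → List (List ℕ) → Maybe (List (List (Fin n)))
toCircuits n []         = just []
toCircuits n (is ∷ iss) = do
  js  ← toFins n is
  jss ← toCircuits n iss
  just (js ∷ jss)

-- From the numbering of plans, where new segments come last, to that of split and
-- attach, where they come first.
rename : (n n′ : ℕ) → ℕ → ℕ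
rename n n′ i = if i <ᵇ n then (n′ ∸ n) + i else n′ ∸ suc i

firstJust : ∀ {A B : Set} → (A → Maybe B) → List A → Maybe B
firstJust f []       = nothing
firstJust f (x ∷ xs) = f x <∣> firstJust f xs

-- Cutting a list at marked members.

-- as₀ ++ x₀ ∷ as₁ ++ x₁ ∷ … ++ asₘ
weave : Vec (List A) (suc m) → Vec A m → List A
weave (a ∷ [])       []       = a
weave (a ∷ as@(_ ∷ _)) (x ∷ xs) = a ++ x ∷ weave as xs

Locus : ℕ → Set
Locus m = Fin m ⊎ Fin (suc m)

At : Vec (List A) (suc m) → Vec A m → Locus m → Pred A 0ℓ
At as xs (inj₁ i) v = v ≡ lookup xs i
At as xs (inj₂ i) v = v ∈ lookup as i

next : Locus m → Locus (suc m)
next (inj₁ i) = inj₁ (suc i)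
next (inj₂ i) = inj₂ (suc i)

at-∈ : ∀ (as : Vec (List A) (suc m)) xs ℓ {v} → At as xs ℓ v → v ∈ weave as xs
at-∈ (a ∷ [])           []       (inj₂ zero)    v∈   = v∈
at-∈ (a ∷ (_ ∷ _))      (x ∷ xs) (inj₁ zero)    refl = ∈-++⁺ʳ a (here refl)
at-∈ (a ∷ as@(_ ∷ _))   (x ∷ xs) (inj₁ (suc i)) eq   = ∈-++⁺ʳ a (there (at-∈ as xs (inj₁ i) eq))
at-∈ (a ∷ (_ ∷ _))      (x ∷ xs) (inj₂ zero)    v∈   = ∈-++⁺ˡ v∈
at-∈ (a ∷ as@(_ ∷ _))   (x ∷ xs) (inj₂ (suc i)) v∈   = ∈-++⁺ʳ a (there (at-∈ as xs (inj₂ i) v∈))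

∈-at : ∀ (as : Vec (List A) (suc m)) xs {v} → v ∈ weave as xs → ∃ λ ℓ → At as xs ℓ v
∈-at (a ∷ [])         []       v∈ = inj₂ zero , v∈
∈-at (a ∷ as@(_ ∷ _)) (x ∷ xs) v∈ with ∈-++⁻ a v∈
... | inj₁ v∈a         = inj₂ zero , v∈a
... | inj₂ (here refl) = inj₁ zero , refl
... | inj₂ (there v∈′) with ∈-at as xs v∈′
...   | inj₁ i , eq    = inj₁ (suc i) , eq
...   | inj₂ i , v∈as  = inj₂ (suc i) , v∈as

-- This makes the nodes and segments lying on one cycle pairwise disjoint.
at-unique : ∀ (as : Vec (List A) (suc m)) xs → Unique (weave as xs) → ∀ ℓ ℓ′ {v} →
            At as xs ℓ v → At as xs ℓ′ v → ℓ ≡ ℓ′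
at-unique (a ∷ [])           []       u (inj₂ zero) (inj₂ zero) _ _ = refl
at-unique {A} (a ∷ as@(_ ∷ _)) (x ∷ xs) u ℓ ℓ′ {v} v∈ v∈′ with unique-++⁻ a u
... | ua , uas@(_ ∷ uas′) , dis = go ℓ ℓ′ v∈ v∈′
  where
  later : ∀ ℓ → At as xs ℓ v → v ∈ weave as xs
  later ℓ = at-∈ as xs ℓ

  x∉ : x ∉ weave as xs
  x∉ = Unique[x∷xs]⇒x∉xs uas

  go : ∀ ℓ ℓ′ → At (a ∷ as) (x ∷ xs) ℓ v → At (a ∷ as) (x ∷ xs) ℓ′ v → ℓ ≡ ℓ′
  go (inj₁ zero)    (inj₁ zero)    _    _    = refl
  go (inj₁ zero)    (inj₂ zero)    refl v∈a  = ⊥-elim (dis (v∈a , here refl))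
  go (inj₁ zero)    (inj₁ (suc j)) refl eq   = contradiction (later (inj₁ j) eq) x∉
  go (inj₁ zero)    (inj₂ (suc j)) refl v∈j  = contradiction (later (inj₂ j) v∈j) x∉
  go (inj₂ zero)    (inj₁ zero)    v∈a  refl = ⊥-elim (dis (v∈a , here refl))
  go (inj₂ zero)    (inj₂ zero)    _    _    = refl
  go (inj₂ zero)    (inj₁ (suc j)) v∈a  eq   = ⊥-elim (dis (v∈a , there (later (inj₁ j) eq)))
  go (inj₂ zero)    (inj₂ (suc j)) v∈a  v∈j  = ⊥-elim (dis (v∈a , there (later (inj₂ j) v∈j)))
  go (inj₁ (suc i)) (inj₁ zero)    eq   refl = contradiction (later (inj₁ i) eq) x∉
  go (inj₂ (suc i)) (inj₁ zero)    v∈i  refl = contradiction (later (inj₂ i) v∈i) x∉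
  go (inj₁ (suc i)) (inj₂ zero)    eq   v∈a  = ⊥-elim (dis (v∈a , there (later (inj₁ i) eq)))
  go (inj₂ (suc i)) (inj₂ zero)    v∈i  v∈a  = ⊥-elim (dis (v∈a , there (later (inj₂ i) v∈i)))
  go (inj₁ (suc i)) (inj₁ (suc j)) eq   eq′  = cong next (at-unique as xs uas′ (inj₁ i) (inj₁ j) eq eq′)
  go (inj₁ (suc i)) (inj₂ (suc j)) eq   v∈j  = cong next (at-unique as xs uas′ (inj₁ i) (inj₂ j) eq v∈j)
  go (inj₂ (suc i)) (inj₁ (suc j)) v∈i  eq′  = cong next (at-unique as xs uas′ (inj₂ i) (inj₁ j) v∈i eq′)
  go (inj₂ (suc i)) (inj₂ (suc j)) v∈i  v∈j  = cong next (at-unique as xs uas′ (inj₂ i) (inj₂ j) v∈i v∈j)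

block-unique : ∀ (as : Vec (List A) (suc m)) xs → Unique (weave as xs) → ∀ i → Unique (lookup as i)
block-unique (a ∷ [])         []       u zero = u
block-unique (a ∷ as@(_ ∷ _)) (x ∷ xs) u i with unique-++⁻ a u
block-unique (a ∷ as@(_ ∷ _)) (x ∷ xs) u zero    | ua , _ , _         = ua
block-unique (a ∷ as@(_ ∷ _)) (x ∷ xs) u (suc i) | _ , (_ ∷ uas) , _  = block-unique as xs uas i

-- There is one more block than there are points. On a closed walk the additional 1 counts the base,
-- so the weights of the segments add up to the length of the cycle.
weave-length : ∀ (as : Vec (List A) (suc m)) xs →
               sum (tabulate (λ i → suc (length (lookup as i)))) ≡ suc (length (weave as xs))
weave-length (a ∷ [])         []       = ℕ.+-identityʳ _
weave-length (a ∷ as@(_ ∷ _)) (x ∷ xs) = cong suc (begin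
  length a + sum (tabulate (λ i → suc (length (lookup as i)))) ≡⟨ cong (length a +_) (weave-length as xs) ⟩
  length a + suc (length (weave as xs))                        ≡⟨ length-++ a ⟨
  length (a ++ x ∷ weave as xs)                                ∎)
  where open ≡-Reasoning

module _ {P : Pred A 0ℓ} (P? : Decidable P) where

  record Weaving (zs : List A) : Set where
    field
      {knots} : ℕ
      blocks  : Vec (List A) (suc knots)
      points  : Vec A knots
      weaves  : weave blocks points ≡ zs
      on      : ∀ i → P (lookup points i)
      off     : ∀ i {v} → v ∈ lookup blocks i → ¬ P v

  unravel : ∀ zs → Weaving zs
  unravel [] = record
    { blocks = [] ∷ [] ; points = [] ; weaves = refl ; on = λ () ; off = λ { zero () } }
  unravel (z ∷ zs) with P? z | unravel zs
  ... | yes Pz | record { blocks = as@(_ ∷ _) ; points = xs ; weaves = refl ; on = on ; off = off } = record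
    { blocks = [] ∷ as ; points = z ∷ xs ; weaves = refl
    ; on  = λ { zero → Pz ; (suc i) → on i }
    ; off = λ { zero () ; (suc i) → off i } }
  ... | no ¬Pz | record { blocks = a ∷ as ; points = xs ; weaves = refl ; on = on ; off = off } = record
    { blocks = (z ∷ a) ∷ as ; points = xs ; weaves = weave-∷ as xs
    ; on  = on
    ; off = λ { zero (here refl) → ¬Pz ; zero (there v∈) → off zero v∈ ; (suc i) → off (suc i) } }
    where
    weave-∷ : ∀ {m a} (as : Vec (List A) m) xs → weave ((z ∷ a) ∷ as) xs ≡ z ∷ weave (a ∷ as) xs
    weave-∷ []      []       = refl
    weave-∷ (_ ∷ _) (x ∷ xs) = refl

reindex : ∀ {k} (xs : Vec A m) (ys : Vec A k) → (∀ j → ∃ λ i → lookup ys j ≡ lookup xs i) →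
          ∃ λ (σ : Vec (Fin m) k) → Vec.map (lookup xs) σ ≡ ys
reindex xs []       _ = [] , refl
reindex xs (y ∷ ys) ∃i with ∃i zero | reindex xs ys (∃i ∘ suc)
... | i , eq | σ , eqs = i ∷ σ , cong₂ _∷_ (sym eq) eqs

toList-∈ : ∀ (xs : Vec A m) {x} → x ∈ toList xs → ∃ λ i → lookup xs i ≡ x
toList-∈ (x ∷ xs) (here refl) = zero , refl
toList-∈ (x ∷ xs) (there x∈)  with toList-∈ xs x∈
... | i , eq = suc i , eq

toList-unique : ∀ (xs : Vec A m) → (∀ i j → lookup xs i ≡ lookup xs j → i ≡ j) → Unique (toList xs)
toList-unique []       inj = []
toList-unique (x ∷ xs) inj = unique-∷
  (λ x∈ → let i , eq = toList-∈ xs x∈ in case inj zero (suc i) (sym eq) of λ ())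
  (toList-unique xs λ i j eq → Fin.suc-injective (inj (suc i) (suc j) eq))

data Side (m n : ℕ) : Fin (m + n) → Set where
  left  : ∀ i → Side m n (i ↑ˡ n)
  right : ∀ j → Side m n (m ↑ʳ j)

side : ∀ m n i → Side m n i
side m n i with splitAt m i | Fin.join-splitAt m n i
... | inj₁ j | refl = left j
... | inj₂ j | refl = right j

-- Realizations

fromJust : ∀ {A : Set} (x : Maybe A) → is-just x ≡ true → A
fromJust (just x) _ = x

-- The bound includes closed walks of two vertices along a single edge. They arise from two parallel
-- segments without interior vertices.
module BoundedCycles {V : Set} (_≟_ : DecidableEquality V) (_~_ : Rel V 0ℓ) (~-sym : Symmetric _~_) (N : ℕ)
  (bound : ∀ {u : V} (xs : List V) → Chains.Chain _~_ u xs u → Unique (u ∷ xs) → suc (length xs) ≤ N) where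

  open Chains _~_

  record Realization (S : Skeleton m k n) : Set where
    field
      node     : Node m k → V
      interior : Fin n → List V

    part : Part m k n → List V
    part = [ (λ ν → node ν ∷ []) , interior ]′

    weight : Fin n → ℕ
    weight e = suc (length (interior e))

    Away : V → Set
    Away v = ∀ i → v ≢ node (anchor i)

    field
      chain     : ∀ e → Chain (node (source S e)) (interior e) (node (target S e))
      unique    : ∀ e → Unique (interior e)
      disjoint  : ∀ p q {x} → x ∈ part p → x ∈ part q → p ≡ q
      weight₁   : sum (map weight (cycle₁ S)) ≡ N
      weight₂   : sum (map weight (cycle₂ S)) ≡ N
      -- Only the anchors are deleted, so this property passes unchanged to subdivisions; the second
      -- path comes from it.
      connected : ∀ {u w} → Away u → Away w → Star (λ a b → a ~ b × Away b) u w

  open Realization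

  module _ {S : Skeleton m k n} (R : Realization S) where

    traverse : ∀ {ν μ} → Step S ν μ → List V
    traverse (forth e) = interior R e
    traverse (back e)  = reverse (interior R e)

    traverse-chain : ∀ {ν μ} (s : Step S ν μ) → Chain (node R ν) (traverse s) (node R μ)
    traverse-chain (forth e) = chain R e
    traverse-chain (back e)  = chain-reverse ~-sym (interior R e) (chain R e)

    traverse-unique : ∀ {ν μ} (s : Step S ν μ) → Unique (traverse s)
    traverse-unique (forth e) = unique R e
    traverse-unique (back e)  = unique-↭ (↭-sym (↭-reverse (interior R e))) (unique R e)

    traverse-∈ : ∀ {ν μ x} (s : Step S ν μ) → x ∈ traverse s → x ∈ interior R (edge s)
    traverse-∈ (forth e) i = i
    traverse-∈ (back e)  i = reverse⁻ i

    traverse-length : ∀ {ν μ} (s : Step S ν μ) → suc (length (traverse s)) ≡ weight R (edge s)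
    traverse-length (forth e) = refl
    traverse-length (back e)  = cong suc (length-reverse (interior R e))

    expand : ∀ {ν μ} → Route S ν μ → List V
    expand [ s ]             = traverse s
    expand (_∷_ {μ = μ} s r) = traverse s ++ node R μ ∷ expand r

    expand-chain : ∀ {ν μ} (r : Route S ν μ) → Chain (node R ν) (expand r) (node R μ)
    expand-chain [ s ]   = traverse-chain s
    expand-chain (s ∷ r) = chain-++ (traverse s) (traverse-chain s) (expand-chain r)

    expand-∈ : ∀ {ν μ x} (r : Route S ν μ) → x ∈ expand r → ∃ λ p → p ∈ parts r × x ∈ part R p
    expand-∈ [ s ]   i = _ , here refl , traverse-∈ s i
    expand-∈ (s ∷ r) i with ∈-++⁻ (traverse s) i
    ... | inj₁ j           = _ , here refl , traverse-∈ s j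
    ... | inj₂ (here refl) = _ , there (here refl) , here refl
    ... | inj₂ (there j) with expand-∈ r j
    ...   | p , p∈ , x∈p   = p , there (there p∈) , x∈p

    expand-∉ : ∀ {ν μ x} (r : Route S ν μ) p → p ∉ parts r → x ∈ part R p → x ∉ expand r
    expand-∉ r p p∉ x∈p x∈r with expand-∈ r x∈r
    ... | q , q∈ , x∈q with disjoint R p q x∈p x∈q
    ...   | refl = p∉ q∈

    expand-unique : ∀ {ν μ} (r : Route S ν μ) → Unique (parts r) → Unique (expand r)
    expand-unique [ s ]   _ = traverse-unique s
    expand-unique (s ∷ r) u@(_ ∷ u′@(_ ∷ u″)) =
      ++⁺ (traverse-unique s)
          (unique-∷ (expand-∉ r (nodeAt _) (Unique[x∷xs]⇒x∉xs u′) (here refl)) (expand-unique r u″))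
          λ { (x∈s , here refl) → Unique[x∷xs]⇒x∉xs u
                (here (disjoint R (segment _) (nodeAt _) (traverse-∈ s x∈s) (here refl)))
            ; (x∈s , there x∈r) → expand-∉ r (segment _) (Unique[x∷xs]⇒x∉xs u ∘ there) (traverse-∈ s x∈s) x∈r }

    expand-length : ∀ {ν μ} (r : Route S ν μ) → suc (length (expand r)) ≡ sum (map (weight R) (edges r))
    expand-length [ s ]   = trans (traverse-length s) (sym (ℕ.+-identityʳ _))
    expand-length (s ∷ r) = trans (cong suc (length-++ (traverse s)))
                                  (cong₂ _+_ (traverse-length s) (expand-length r))

    circuit-bound : (c : Circuit S) → sum (map (weight R) (circuitEdges c)) ≤ N
    circuit-bound record { route = r ; simple = u@(_ ∷ u′) } =
      subst (_≤ N) (expand-length r)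
        (bound (expand r) (expand-chain r)
          (unique-∷ (expand-∉ r (nodeAt _) (Unique[x∷xs]⇒x∉xs u) (here refl)) (expand-unique r u′)))

    circuits-bound : (cs : List (Circuit S)) →
                     sum (map (weight R) (concatMap circuitEdges cs)) ≤ length cs * N
    circuits-bound []       = z≤n
    circuits-bound (c ∷ cs) = begin
      sum (map (weight R) (circuitEdges c ++ concatMap circuitEdges cs)) ≡⟨ sum-map-++ (weight R) (circuitEdges c) _ ⟩
      sum (map (weight R) (circuitEdges c)) + sum (map (weight R) (concatMap circuitEdges cs))
        ≤⟨ ℕ.+-mono-≤ (circuit-bound c) (circuits-bound cs) ⟩
      N + length cs * N ∎
      where open ℕ.≤-Reasoning

  Refuted : Skeleton m k n → List (Fin n) → Set
  Refuted S Z = (R : Realization S) → (∀ {z} → z ∈ Z → interior R z ≡ []) → ⊥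

  -- If every cycle has at most N vertices, circuits that together outweigh as many
  -- copies of the two cycles of length N cannot exist.
  certify : (S : Skeleton m k n) (Z : List (Fin n)) → ℕ × List (List (Fin n)) → Maybe (Refuted S Z)
  certify S Z (a , ess) = do
    cs ← circuits? S ess
    let b = length cs ∸ a
    yes a≤ ← just (a ≤? length cs) where no _ → nothing
    d , rest , eq ← balance Z (copies a (cycle₁ S) ++ copies b (cycle₂ S)) (concatMap circuitEdges cs)
    yes d< ← just (d <? length rest) where no _ → nothing
    just λ R empty →
      let w = weight R
          unit : ∀ {z} → z ∈ Z → w z ≡ 1
          unit z∈Z = cong (suc ∘ length) (empty z∈Z)
          copies-weight : sum (map w (copies a (cycle₁ S) ++ copies b (cycle₂ S))) ≡ length cs * N
          copies-weight = begin-equality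
            sum (map w (copies a (cycle₁ S) ++ copies b (cycle₂ S)))
              ≡⟨ sum-map-++ w (copies a (cycle₁ S)) _ ⟩
            sum (map w (copies a (cycle₁ S))) + sum (map w (copies b (cycle₂ S)))
              ≡⟨ cong₂ _+_ (sum-copies w a (cycle₁ S)) (sum-copies w b (cycle₂ S)) ⟩
            a * sum (map w (cycle₁ S)) + b * sum (map w (cycle₂ S))
              ≡⟨ cong₂ (λ x y → a * x + b * y) (weight₁ R) (weight₂ R) ⟩
            a * N + b * N     ≡⟨ ℕ.*-distribʳ-+ N a b ⟨
            (a + b) * N       ≡⟨ cong (_* N) (ℕ.m+[n∸m]≡n a≤) ⟩
            length cs * N     ∎
      in ℕ.<-irrefl refl (begin-strict
        length cs * N + d                  <⟨ ℕ.+-monoʳ-< (length cs * N) d< ⟩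
        length cs * N + length rest        ≤⟨ ℕ.+-monoʳ-≤ (length cs * N) (length≤sum w (λ _ → s≤s z≤n) rest) ⟩
        length cs * N + sum (map w rest)   ≡⟨ cong (_+ sum (map w rest)) copies-weight ⟨
        sum (map w (copies a (cycle₁ S) ++ copies b (cycle₂ S))) + sum (map w rest) ≡⟨ eq w unit ⟨
        sum (map w (concatMap circuitEdges cs)) + d ≤⟨ ℕ.+-monoˡ-≤ d (circuits-bound R cs) ⟩
        length cs * N + d                  ∎)
    where open ℕ.≤-Reasoning

  -- Subdivision and attachment for realizations.

  module Split {S : Skeleton m k n} (R : Realization S) (e : Fin n) {x : V} (xs ys : List V)
               (eq : interior R e ≡ xs ++ x ∷ ys) where

    splitNode : Node m (suc k) → V
    splitNode (anchor i)     = node R (anchor i)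
    splitNode (free zero)    = x
    splitNode (free (suc j)) = node R (free j)

    firstHalf : ∀ {f} → Dec (f ≡ e) → List V
    firstHalf     (yes _) = xs
    firstHalf {f} (no _)  = interior R f

    splitInterior : Fin (suc n) → List V
    splitInterior zero    = ys
    splitInterior (suc f) = firstHalf (f Fin.≟ e)

    splitPart : Part m (suc k) (suc n) → List V
    splitPart = [ (λ ν → splitNode ν ∷ []) , splitInterior ]′

    splitNode-raise : ∀ ν → splitNode (raise ν) ≡ node R ν
    splitNode-raise (anchor i) = refl
    splitNode-raise (free j)   = refl

    private
      chain-e : Chain (node R (source S e)) (xs ++ x ∷ ys) (node R (target S e))
      chain-e = subst (λ zs → Chain _ zs _) eq (chain R e)

      unique-e : Unique xs × Unique (x ∷ ys) × Disjoint xs (x ∷ ys)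
      unique-e = unique-++⁻ xs (subst Unique eq (unique R e))

    firstHalf-∈ : ∀ {f v} (d : Dec (f ≡ e)) → v ∈ firstHalf d → v ∈ interior R f
    firstHalf-∈ (yes refl) v∈ = subst (_ ∈_) (sym eq) (∈-++⁺ˡ v∈)
    firstHalf-∈ (no _)     v∈ = v∈

    splitInterior-kept : ∀ {f} → f ≢ e → splitInterior (suc f) ≡ interior R f
    splitInterior-kept {f} f≢e with f Fin.≟ e
    ... | yes f≡e = contradiction f≡e f≢e
    ... | no _    = refl

    lift : Part m k n → Part m (suc k) (suc n)
    lift (nodeAt ν)  = nodeAt (raise ν)
    lift (segment f) = segment (suc f)

    data View : Part m (suc k) (suc n) → Set where
      lifted : ∀ p → View (lift p)
      middle : View (nodeAt (free zero))
      second : View (segment zero)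

    view : ∀ p → View p
    view (nodeAt (anchor i))     = lifted (nodeAt (anchor i))
    view (nodeAt (free zero))    = middle
    view (nodeAt (free (suc j))) = lifted (nodeAt (free j))
    view (segment zero)          = second
    view (segment (suc f))       = lifted (segment f)

    lift-∈ : ∀ p {v} → v ∈ splitPart (lift p) → v ∈ part R p
    lift-∈ (nodeAt (anchor i)) v∈ = v∈
    lift-∈ (nodeAt (free j))   v∈ = v∈
    lift-∈ (segment f)         v∈ = firstHalf-∈ (f Fin.≟ e) v∈

    splitPart-∈ : ∀ p {v} → v ∈ splitPart p → ∃ λ q → v ∈ part R q
    splitPart-∈ p v∈ with view p
    ... | lifted q = q , lift-∈ q v∈
    ... | middle   = segment e , subst (_ ∈_) (sym eq) (∈-++⁺ʳ xs (∈-++⁺ˡ v∈))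
    ... | second   = segment e , subst (_ ∈_) (sym eq) (∈-++⁺ʳ xs (there v∈))

    -- A vertex of `x ∷ ys` belongs to the old segment `e` and to no other old part. What keeps the
    -- name of `e` is only `xs`, which is disjoint from `x ∷ ys`.
    lifted-clash : ∀ p {v} → v ∈ splitPart (lift p) → v ∈ x ∷ ys → ⊥
    lifted-clash p v∈ v∈′
      with disjoint R p (segment e) (lift-∈ p v∈) (subst (_ ∈_) (sym eq) (∈-++⁺ʳ xs v∈′))
    ... | refl with e Fin.≟ e
    ...   | yes _   = proj₂ (proj₂ unique-e) (v∈ , v∈′)
    ...   | no  e≢e = e≢e refl

    x∉ys : x ∉ ys
    x∉ys = Unique[x∷xs]⇒x∉xs (proj₁ (proj₂ unique-e))

    splitPart-disjoint : ∀ p q {v} → v ∈ splitPart p → v ∈ splitPart q → p ≡ q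
    splitPart-disjoint p q v∈p v∈q with view p | view q
    ... | lifted p′ | lifted q′ = cong lift (disjoint R p′ q′ (lift-∈ p′ v∈p) (lift-∈ q′ v∈q))
    ... | lifted p′ | middle    = ⊥-elim (lifted-clash p′ v∈p (∈-++⁺ˡ v∈q))
    ... | lifted p′ | second    = ⊥-elim (lifted-clash p′ v∈p (there v∈q))
    ... | middle    | lifted q′ = ⊥-elim (lifted-clash q′ v∈q (∈-++⁺ˡ v∈p))
    ... | second    | lifted q′ = ⊥-elim (lifted-clash q′ v∈q (there v∈p))
    ... | middle    | middle    = refl
    ... | second    | second    = refl
    splitPart-disjoint p q (here refl) v∈q | middle | second = contradiction v∈q x∉ys
    splitPart-disjoint p q v∈p (here refl) | second | middle = contradiction v∈p x∉ys

    splitWeight : Fin (suc n) → ℕ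
    splitWeight f = suc (length (splitInterior f))

    halves-weight : ∀ fs → sum (map splitWeight (halves e fs)) ≡ sum (map (weight R) fs)
    halves-weight []       = refl
    halves-weight (f ∷ fs) with f Fin.≟ e in f≟e
    ... | no _ rewrite f≟e = cong (weight R f +_) (halves-weight fs)
    ... | yes refl rewrite f≟e = begin
      suc (length xs) + (suc (length ys) + sum (map splitWeight (halves f fs)))
        ≡⟨ ℕ.+-assoc (suc (length xs)) _ _ ⟨
      suc (length xs + suc (length ys)) + sum (map splitWeight (halves f fs))
        ≡⟨ cong₂ (λ a b → suc a + b) (sym (length-++ xs)) (halves-weight fs) ⟩
      suc (length (xs ++ x ∷ ys)) + sum (map (weight R) fs)
        ≡⟨ cong (λ zs → suc (length zs) + sum (map (weight R) fs)) eq ⟨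
      weight R f + sum (map (weight R) fs) ∎
      where open ≡-Reasoning

    splitChain : ∀ f → Chain (splitNode (source (split S e) f)) (splitInterior f)
                             (splitNode (target (split S e) f))
    splitChain zero = subst (Chain x ys) (sym (splitNode-raise (target S e)))
                            (proj₂ (chain-split xs chain-e))
    splitChain (suc f) with f Fin.≟ e
    ... | yes refl = subst (λ v → Chain v xs x) (sym (splitNode-raise (source S f)))
                           (proj₁ (chain-split xs chain-e))
    ... | no _     = subst₂ (λ u w → Chain u (interior R f) w)
                            (sym (splitNode-raise (source S f))) (sym (splitNode-raise (target S f)))
                            (chain R f)

    splitUnique : ∀ f → Unique (splitInterior f)
    splitUnique zero with proj₁ (proj₂ unique-e)
    ... | _ ∷ u = u
    splitUnique (suc f) with f Fin.≟ e
    ... | yes _ = proj₁ unique-e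
    ... | no _  = unique R f

    splitRealization : Realization (split S e)
    splitRealization = record
      { node      = splitNode
      ; interior  = splitInterior
      ; chain     = splitChain
      ; unique    = splitUnique
      ; disjoint  = splitPart-disjoint
      ; weight₁   = trans (halves-weight (cycle₁ S)) (weight₁ R)
      ; weight₂   = trans (halves-weight (cycle₂ S)) (weight₂ R)
      ; connected = connected R
      }

  module Attach {m k n} {S : Skeleton m k n} (R : Realization S) {ν μ : Node m k} (xs : List V)
                (c : Chain (node R ν) xs (node R μ)) (uxs : Unique xs)
                (outside : ∀ p {v} → v ∈ xs → v ∉ part R p) where

    attachInterior : Fin (suc n) → List V
    attachInterior zero    = xs
    attachInterior (suc f) = interior R f

    attachRealization : Realization (attach S ν μ)
    attachRealization = record
      { node      = node R
      ; interior  = attachInterior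
      ; chain     = λ { zero → c ; (suc f) → chain R f }
      ; unique    = λ { zero → uxs ; (suc f) → unique R f }
      ; disjoint  = attachDisjoint
      ; weight₁   = trans (cong sum (sym (map-∘ (cycle₁ S)))) (weight₁ R)
      ; weight₂   = trans (cong sum (sym (map-∘ (cycle₂ S)))) (weight₂ R)
      ; connected = connected R
      }
      where
      attachPart : Part m k (suc n) → List V
      attachPart = [ (λ ν → node R ν ∷ []) , attachInterior ]′

      liftₐ : Part m k n → Part m k (suc n)
      liftₐ (nodeAt κ)  = nodeAt κ
      liftₐ (segment f) = segment (suc f)

      attachDisjoint : ∀ p q {v} → v ∈ attachPart p → v ∈ attachPart q → p ≡ q
      attachDisjoint (segment zero)    (segment zero)    v∈p v∈q = refl
      attachDisjoint (segment zero)    (nodeAt κ)        v∈p v∈q = ⊥-elim (outside (nodeAt κ) v∈p v∈q)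
      attachDisjoint (segment zero)    (segment (suc f)) v∈p v∈q = ⊥-elim (outside (segment f) v∈p v∈q)
      attachDisjoint (nodeAt κ)        (segment zero)    v∈p v∈q = ⊥-elim (outside (nodeAt κ) v∈q v∈p)
      attachDisjoint (segment (suc f)) (segment zero)    v∈p v∈q = ⊥-elim (outside (segment f) v∈q v∈p)
      attachDisjoint (nodeAt κ)        (nodeAt ι)        v∈p v∈q = cong liftₐ (disjoint R (nodeAt κ) (nodeAt ι) v∈p v∈q)
      attachDisjoint (nodeAt κ)        (segment (suc g)) v∈p v∈q = cong liftₐ (disjoint R (nodeAt κ) (segment g) v∈p v∈q)
      attachDisjoint (segment (suc f)) (nodeAt ι)        v∈p v∈q = cong liftₐ (disjoint R (segment f) (nodeAt ι) v∈p v∈q)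
      attachDisjoint (segment (suc f)) (segment (suc g)) v∈p v∈q = cong liftₐ (disjoint R (segment f) (segment g) v∈p v∈q)

  -- Leaving a region along a second path.

  module Escape {S : Skeleton m k n} (R : Realization S) (inU : Fin n → Bool)
    (to-segment : ∀ e f → inU e ≡ true → inU f ≡ false → Realization (segmentChild S e f) → ⊥)
    (to-node    : ∀ e j → inU e ≡ true → Realization (nodeChild S e j) → ⊥) where

    Inside Landing Outside : V → Set
    Inside v  = ∃ λ e → inU e ≡ true × v ∈ interior R e
    Landing v = (∃ λ f → inU f ≡ false × v ∈ interior R f) ⊎ (∃ λ j → v ≡ node R (free j))
    Outside v = ∀ p → v ∉ part R p

    classify : ∀ v → Away R v → Inside v ⊎ Landing v ⊎ Outside v
    classify v away with Fin.any? (λ e → DecMembership._∈?_ _≟_ v (interior R e))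
                       | Fin.any? (λ j → v ≟ node R (free j))
    ... | yes (e , v∈) | _ with inU e in eq
    ...   | true  = inj₁ (e , eq , v∈)
    ...   | false = inj₂ (inj₁ (inj₁ (e , eq , v∈)))
    classify v away | no _ | yes j = inj₂ (inj₁ (inj₂ j))
    classify v away | no ∄e | no ∄j = inj₂ (inj₂ outside)
      where
      outside : Outside v
      outside (nodeAt (anchor i)) (here eq) = away i eq
      outside (nodeAt (free j))   (here eq) = ∄j (j , eq)
      outside (segment e)         v∈        = ∄e (e , v∈)

    Inside∩Landing=∅ : ∀ {v} → Inside v → Landing v → ⊥
    Inside∩Landing=∅ (e , e∈U , v∈e) (inj₁ (f , f∉U , v∈f))
      with disjoint R (segment e) (segment f) v∈e v∈f
    ... | refl = case trans (sym e∈U) f∉U of λ ()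
    Inside∩Landing=∅ (e , e∈U , v∈e) (inj₂ (j , refl))
      with disjoint R (segment e) (nodeAt (free j)) v∈e (here refl)
    ... | ()

    inside-away : ∀ {v} → Inside v → Away R v
    inside-away (e , _ , v∈) i refl with disjoint R (segment e) (nodeAt (anchor i)) v∈ (here refl)
    ... | ()

    landed : Bridge _≟_ classify Inside∩Landing=∅ → ⊥
    landed (u , t , zs , (e , e∈U , u∈e) , inj₂ (j , refl) , c , uzs , zs-out)
      with ∈-∃++ u∈e
    ... | xs , ys , eq = to-node e j e∈U
      (attachRealization zs c uzs λ p v∈zs v∈p →
        let q , v∈q = splitPart-∈ p v∈p in zs-out v∈zs q v∈q)
      where
      open Split R e xs ys eq
      open Attach splitRealization {free zero} {free (suc j)}
    landed (u , t , zs , (e , e∈U , u∈e) , inj₁ (f , f∉U , t∈f) , c , uzs , zs-out)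
      with ∈-∃++ u∈e
    -- The landing segment lies outside the region, so subdividing `e` has left its interior as it
    -- was.
    ... | xs , ys , eq with ∈-∃++ (subst (t ∈_) (sym (Split.splitInterior-kept R e xs ys eq f≢e)) t∈f)
      where
      f≢e : f ≢ e
      f≢e refl = case trans (sym e∈U) f∉U of λ ()
    ...   | xs′ , ys′ , eq′ = to-segment e f e∈U f∉U
      (attachRealization zs c uzs λ p v∈zs v∈p →
        let q , v∈q = Split.splitPart-∈ R₁ (suc f) xs′ ys′ eq′ p v∈p
            r , v∈r = Split.splitPart-∈ R e xs ys eq q v∈q
        in zs-out v∈zs r v∈r)
      where
      R₁ = Split.splitRealization R e xs ys eq
      R₂ = Split.splitRealization R₁ (suc f) xs′ ys′ eq′
      open Attach R₂ {free (suc zero)} {free zero}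

    -- A free node is not an anchor, so some walk avoiding the anchors joins it to an interior
    -- vertex of the region. A bridge on this walk leaves the region and realizes one of the refuted
    -- children.
    escape : ∀ e → inU e ≡ true → interior R e ≢ [] → Fin k → ⊥
    escape e e∈U nonempty j with interior R e in eq
    ... | []    = nonempty refl
    ... | v ∷ _ = landed (bridge _≟_ classify Inside∩Landing=∅ v∈U (inj₂ (j , refl))
                           (connected R (inside-away v∈U) away))
      where
      v∈U : Inside v
      v∈U = e , e∈U , subst (v ∈_) (sym eq) (here refl)

      away : Away R (node R (free j))
      away i eq′ with disjoint R (nodeAt (free j)) (nodeAt (anchor i)) (here refl) (here eq′)
      ... | ()

  -- Running the certificates.

  certifyℕ : ∀ {m} (S : Skeleton m k n) Z → (ℕ → ℕ) → ℕ × List (List ℕ) → Maybe (Refuted S Z)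
  certifyℕ {n = n} S Z f (a , iss) = do
    jss ← toCircuits n (map (map f) iss)
    certify S Z (a , jss)

  Impossible : ∀ {m} → Skeleton m k n → Set
  Impossible S = Realization S → ⊥

  refute : ∀ {m} (S : Skeleton m k n) → (ℕ → ℕ) → ℕ × List (List ℕ) → Maybe (Impossible S)
  refute S f cert = do
    r ← certifyℕ S [] f cert
    just λ R → r R λ ()

  module _ {m : ℕ} (S : Skeleton m 2 n) (plan : Plan) (swap flip₁ flip₂ : Bool) where
    open Symmetry m swap flip₁ flip₂
    open Plan plan

    inRegion : Fin n → Bool
    inRegion e = toℕ e ∈ᵇ map image region

    segment? : ∀ e f → Maybe (inRegion e ≡ true → inRegion f ≡ false → Impossible (segmentChild S e f))
    segment? e f with inRegion e | inRegion f
    ... | false | _     = just λ ()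
    ... | true  | true  = just λ _ ()
    ... | true  | false = do
      r ← refute (segmentChild S e f) (rename n (3 + n)) (lookupEntry table (toℕ e) (toℕ f))
      just λ _ _ → r

    node? : ∀ e j → Maybe (inRegion e ≡ true → Impossible (nodeChild S e j))
    node? e j with inRegion e
    ... | false = just λ ()
    ... | true  = do
      -- For `tieUp` the number `n` equals `size`, so this sum is the code of p or q in the table.
      r ← refute (nodeChild S e j) (rename n (2 + n)) (lookupEntry table (toℕ e) (n + toℕ j))
      just λ _ → r

    execute : Maybe (Impossible S)
    execute = do
      e ← toFin n (image inner)
      stretched ← certifyℕ S (e ∷ []) (λ i → i) (imageCertificate image stretch)
      yes e∈U ← just (inRegion e Bool.≟ true) where no _ → nothing
      segments ← all-fin? (λ e → all-fin? (segment? e))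
      nodes    ← all-fin? (λ e → all-fin? (node? e))
      -- The certificate `stretched` excludes an empty interior of `e`; the final `zero` makes p the
      -- goal of the walk.
      just λ R → Escape.escape R inRegion segments nodes e e∈U
        (λ empty → stretched R λ { (here refl) → empty }) zero

  symmetries : List (Bool × Bool × Bool)
  symmetries = (false , false , false) ∷ (false , false , true) ∷ (false , true , false) ∷ (false , true , true)
             ∷ (true , false , false) ∷ (true , false , true) ∷ (true , true , false) ∷ (true , true , true) ∷ []

  -- Each stored plan treats a single order of its class, so it is tried in all eight symmetric
  -- forms.
  refuteTie : ∀ {m} (σ : Vec (Fin m) m) → Maybe (Impossible (tieUp σ))
  refuteTie {m} σ = refute (tieUp σ) (λ i → i) (Search.pairing σ)
    <∣> firstJust (λ { (plan , s , f₁ , f₂) → execute (tieUp σ) plan s f₁ f₂ })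
          (cartesianProduct (if m ≡ᵇ 4 then fourFold ∷ [] else fiveFold ∷ twisted ∷ []) symmetries)

  refuteTies : ∀ m → Maybe (∀ (σ : Vec (Fin m) m) → Unique (toList σ) → Impossible (tieUp σ))
  refuteTies m = all-vec? λ σ → case DecUnique.unique? Fin._≟_ (toList σ) of λ where
    (no ¬u) → just λ u → contradiction u ¬u
    (yes _) → do
      r ← refuteTie σ
      just λ _ → r

  -- Two tied cycles as a realization.

  weave-chain : ∀ {u w} (as : Vec (List V) (suc m)) xs → Chain u (weave as xs) w →
                ∀ i → Chain (lookup (u ∷ xs) i) (lookup as i) (lookup (xs ∷ʳ w) i)
  weave-chain (a ∷ [])         []       c zero = c
  weave-chain (a ∷ as@(_ ∷ _)) (x ∷ xs) c i with chain-split a c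
  weave-chain (a ∷ as@(_ ∷ _)) (x ∷ xs) c zero    | c₁ , _  = c₁
  weave-chain (a ∷ as@(_ ∷ _)) (x ∷ xs) c (suc i) | _  , c₂ = weave-chain as xs c₂ i

  -- The proofs `refl` make type checking evaluate the search for every order. The range comes from
  -- the apex, which is always common, and at most four further common vertices.
  tie-impossible : ∀ {m} → 1 ≤ m → m ≤ 5 → (σ : Vec (Fin m) m) → Unique (toList σ) → Impossible (tieUp σ)
  tie-impossible {0} () _
  tie-impossible {1} _ _ = fromJust (refuteTies 1) refl
  tie-impossible {2} _ _ = fromJust (refuteTies 2) refl
  tie-impossible {3} _ _ = fromJust (refuteTies 3) refl
  tie-impossible {4} _ _ = fromJust (refuteTies 4) refl
  tie-impossible {5} _ _ = fromJust (refuteTies 5) refl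
  tie-impossible {suc (suc (suc (suc (suc (suc _)))))} _ (s≤s (s≤s (s≤s (s≤s (s≤s ())))))

  record Tie (p q : V) (cs ds rs : List V) : Set where
    field
      chain₁   : Chain p cs p
      chain₂   : Chain q ds q
      chainᵣ   : Chain p rs q
      unique₁  : Unique (p ∷ cs)
      unique₂  : Unique (q ∷ ds)
      uniqueᵣ  : Unique rs
      length₁  : suc (length cs) ≡ N
      length₂  : suc (length ds) ≡ N
      avoids₁  : ∀ {v} → v ∈ rs → v ∉ p ∷ cs
      avoids₂  : ∀ {v} → v ∈ rs → v ∉ q ∷ ds
      p∉₂      : p ∉ q ∷ ds
      q∉₁      : q ∉ p ∷ cs

    Common : V → Set
    Common v = v ∈ cs × v ∈ ds

  module Realize {m} {p q : V} {rs} (as bs : Vec (List V) (suc m)) (xs : Vec V m) (σ : Vec (Fin m) m)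
    (tie : Tie p q (weave as xs) (weave bs (Vec.map (lookup xs) σ)) rs)
    (off : ∀ j {v} → v ∈ lookup bs j → v ∉ weave as xs)
    (on : ∀ i → lookup xs i ∈ weave bs (Vec.map (lookup xs) σ))
    (connected : ∀ {u w} → ¬ Tie.Common tie u → ¬ Tie.Common tie w →
                 Star (λ a b → a ~ b × ¬ Tie.Common tie b) u w)
    where
    open Tie tie

    ys : Vec V m
    ys = Vec.map (lookup xs) σ

    tieNode : Node m 2 → V
    tieNode (anchor i)          = lookup xs i
    tieNode (free zero)         = p
    tieNode (free (suc zero))   = q

    interiors : Vec (List V) (1 + (suc m + suc m))
    interiors = rs ∷ as ++ⱽ bs

    tiePart : Part m 2 (1 + (suc m + suc m)) → List V
    tiePart = [ (λ ν → tieNode ν ∷ []) , lookup interiors ]′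

    anchors : Vec (Node m 2) m
    anchors = Vec.map anchor (allFin m)

    anchors-points : Vec.map tieNode anchors ≡ xs
    anchors-points = trans (sym (mapⱽ-∘ tieNode anchor (allFin m))) (map-lookup-allFin xs)

    σ-points : Vec.map tieNode (Vec.map anchor σ) ≡ ys
    σ-points = sym (mapⱽ-∘ tieNode anchor σ)

    node-chain : ∀ {zs ν μ} {νs : Vec (Node m 2) m} (bs : Vec (List V) (suc m)) → Vec.map tieNode νs ≡ zs →
                 Chain (tieNode ν) (weave bs zs) (tieNode μ) →
                 ∀ i → Chain (tieNode (lookup (ν ∷ νs) i)) (lookup bs i) (tieNode (lookup (νs ∷ʳ μ) i))
    node-chain {ν = ν} {μ} {νs} bs refl c i =
      subst₂ (λ u w → Chain u (lookup bs i) w) (lookup-map i tieNode (ν ∷ νs))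
        (trans (cong (λ v → lookup v i) (sym (map-∷ʳ tieNode μ νs))) (lookup-map i tieNode (νs ∷ʳ μ)))
        (weave-chain bs (Vec.map tieNode νs) c i)

    tie-chain : ∀ e → Chain (tieNode (source (tieUp σ) e)) (lookup interiors e) (tieNode (target (tieUp σ) e))
    tie-chain zero    = chainᵣ
    tie-chain (suc e) with side (suc m) (suc m) e
    ... | left i
      rewrite lookup-++ˡ (free zero ∷ anchors) (free (suc zero) ∷ Vec.map anchor σ) i
            | lookup-++ˡ as bs i
            | lookup-++ˡ (anchors ∷ʳ free zero) (Vec.map anchor σ ∷ʳ free (suc zero)) i
      = node-chain as anchors-points chain₁ i
    ... | right j
      rewrite lookup-++ʳ (free zero ∷ anchors) (free (suc zero) ∷ Vec.map anchor σ) j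
            | lookup-++ʳ as bs j
            | lookup-++ʳ (anchors ∷ʳ free zero) (Vec.map anchor σ ∷ʳ free (suc zero)) j
      = node-chain bs σ-points chain₂ j

    tie-unique : ∀ e → Unique (lookup interiors e)
    tie-unique zero    = uniqueᵣ
    tie-unique (suc e) with side (suc m) (suc m) e | unique₁ | unique₂
    ... | left i  | _ ∷ u | _     rewrite lookup-++ˡ as bs i = block-unique as xs u i
    ... | right j | _     | _ ∷ u rewrite lookup-++ʳ as bs j = block-unique bs ys u j

    -- The base of each cycle becomes a point of its own behind an empty block, so that `at-unique`
    -- covers it too. The empty block holds no vertex and gets segment zero as a default.
    place₁ place₂ : Locus (suc m) → Part m 2 (1 + (suc m + suc m))
    place₁ (inj₁ zero)    = nodeAt (free zero)
    place₁ (inj₁ (suc i)) = nodeAt (anchor i)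
    place₁ (inj₂ zero)    = segment zero
    place₁ (inj₂ (suc i)) = segment (suc (i ↑ˡ suc m))
    place₂ (inj₁ zero)    = nodeAt (free (suc zero))
    place₂ (inj₁ (suc j)) = nodeAt (anchor (lookup σ j))
    place₂ (inj₂ zero)    = segment zero
    place₂ (inj₂ (suc j)) = segment (suc (suc m ↑ʳ j))

    -- A vertex of the figure lies on the first cycle, on the second but not the first, or inside
    -- the connecting path. The anchors count as first. These cases exclude each other, and within
    -- each the locus determines the part.
    data Kind (v : V) : Part m 2 (1 + (suc m + suc m)) → Set where
      first  : ∀ ℓ → At ([] ∷ as) (p ∷ xs) ℓ v → Kind v (place₁ ℓ)
      second : ∀ ℓ → At ([] ∷ bs) (q ∷ ys) ℓ v → v ∉ p ∷ weave as xs → Kind v (place₂ ℓ)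
      across : v ∈ rs → Kind v (segment zero)

    kind : ∀ κ {v} → v ∈ tiePart κ → Kind v κ
    kind (nodeAt (anchor i))        (here refl) = first (inj₁ (suc i)) refl
    kind (nodeAt (free zero))       (here refl) = first (inj₁ zero) refl
    kind (nodeAt (free (suc zero))) (here refl) = second (inj₁ zero) refl q∉₁
    kind (segment zero)             v∈          = across v∈
    kind (segment (suc e))          v∈ with side (suc m) (suc m) e
    ... | left i  rewrite lookup-++ˡ as bs i = first (inj₂ (suc i)) v∈
    ... | right j rewrite lookup-++ʳ as bs j = second (inj₂ (suc j)) v∈
      λ { (here refl) → p∉₂ (there (at-∈ bs ys (inj₂ j) v∈)) ; (there v∈′) → off j v∈ v∈′ }

    weave-[] : ∀ {x : V} {m} (as : Vec (List V) (suc m)) xs → weave ([] ∷ as) (x ∷ xs) ≡ x ∷ weave as xs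
    weave-[] (_ ∷ _) xs = refl

    at-∈₁ : ∀ ℓ {v} → At ([] ∷ as) (p ∷ xs) ℓ v → v ∈ p ∷ weave as xs
    at-∈₁ ℓ at = subst (_ ∈_) (weave-[] as xs) (at-∈ ([] ∷ as) (p ∷ xs) ℓ at)

    at-∈₂ : ∀ ℓ {v} → At ([] ∷ bs) (q ∷ ys) ℓ v → v ∈ q ∷ weave bs ys
    at-∈₂ ℓ at = subst (_ ∈_) (weave-[] bs ys) (at-∈ ([] ∷ bs) (q ∷ ys) ℓ at)

    kind-unique : ∀ {κ ι v} → Kind v κ → Kind v ι → κ ≡ ι
    kind-unique (first ℓ at) (first ℓ′ at′) = cong place₁
      (at-unique ([] ∷ as) (p ∷ xs) (subst Unique (sym (weave-[] as xs)) unique₁) ℓ ℓ′ at at′)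
    kind-unique (second ℓ at _) (second ℓ′ at′ _) = cong place₂
      (at-unique ([] ∷ bs) (q ∷ ys) (subst Unique (sym (weave-[] bs ys)) unique₂) ℓ ℓ′ at at′)
    kind-unique (across _) (across _) = refl
    kind-unique (first ℓ at)       (second _ _ v∉)     = contradiction (at-∈₁ ℓ at) v∉
    kind-unique (second _ _ v∉)    (first ℓ at)        = contradiction (at-∈₁ ℓ at) v∉
    kind-unique (first ℓ at)       (across v∈)         = contradiction (at-∈₁ ℓ at) (avoids₁ v∈)
    kind-unique (across v∈)        (first ℓ at)        = contradiction (at-∈₁ ℓ at) (avoids₁ v∈)
    kind-unique (second ℓ at _)    (across v∈)         = contradiction (at-∈₂ ℓ at) (avoids₂ v∈)
    kind-unique (across v∈)        (second ℓ at _)     = contradiction (at-∈₂ ℓ at) (avoids₂ v∈)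

    point-common : ∀ i → Common (lookup xs i)
    point-common i = at-∈ as xs (inj₁ i) refl , on i

    tieWeight : Fin (1 + (suc m + suc m)) → ℕ
    tieWeight e = suc (length (lookup interiors e))

    tie-weight : ∀ (f : Fin (suc m) → Fin (1 + (suc m + suc m))) (cs : Vec (List V) (suc m)) zs →
                 (∀ i → lookup interiors (f i) ≡ lookup cs i) → suc (length (weave cs zs)) ≡ N →
                 sum (map tieWeight (tabulate f)) ≡ N
    tie-weight f cs zs eq len = begin
      sum (map tieWeight (tabulate f))                        ≡⟨ cong sum (map-tabulate f tieWeight) ⟩
      sum (tabulate (tieWeight ∘ f))                          ≡⟨ cong sum (tabulate-cong (cong (suc ∘ length) ∘ eq)) ⟩
      sum (tabulate (λ i → suc (length (lookup cs i))))    ≡⟨ weave-length cs zs ⟩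
      suc (length (weave cs zs))                           ≡⟨ len ⟩
      N                                                    ∎
      where open ≡-Reasoning

    away⇒¬common : ∀ {v} → (∀ i → v ≢ lookup xs i) → ¬ Common v
    away⇒¬common away (v∈₁ , v∈₂) with ∈-at bs ys v∈₂
    ... | inj₁ j , refl = away (lookup σ j) (lookup-map j (lookup xs) σ)
    ... | inj₂ j , v∈b  = off j v∈b v∈₁

    tieRealization : Realization (tieUp σ)
    tieRealization = record
      { node      = tieNode
      ; interior  = lookup interiors
      ; chain     = tie-chain
      ; unique    = tie-unique
      ; disjoint  = λ κ ι v∈κ v∈ι → kind-unique (kind κ v∈κ) (kind ι v∈ι)
      ; weight₁   = tie-weight (λ i → suc (i ↑ˡ suc m)) as xs (lookup-++ˡ as bs) length₁
      ; weight₂   = tie-weight (λ i → suc (suc m ↑ʳ i)) bs ys (lookup-++ʳ as bs) length₂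
      ; connected = λ au aw → Star.map
          (λ { (a~b , ¬common) → a~b , λ { i refl → ¬common (point-common i) } })
          (connected (away⇒¬common au) (away⇒¬common aw))
      }

  points-injective : ∀ {m} (as : Vec (List V) (suc m)) xs → Unique (weave as xs) →
                     ∀ i j → lookup xs i ≡ lookup xs j → i ≡ j
  points-injective as xs u i j eq with at-unique as xs u (inj₁ i) (inj₁ j) refl eq
  ... | refl = refl

  open Weaving

  points-among : ∀ {cs ds} (w : Weaving (λ v → DecMembership._∈?_ _≟_ v ds) cs) →
                 ∀ {v} → v ∈ cs → v ∈ ds → ∃ λ i → v ≡ lookup (points w) i
  points-among record { blocks = as ; points = xs ; weaves = refl ; off = off } v∈cs v∈ds
    with ∈-at as xs v∈cs
  ... | inj₁ i , eq  = i , eq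
  ... | inj₂ i , v∈a = contradiction v∈ds (off i v∈a)

  -- Cutting either cycle at the vertices of the other yields the same points in two orders, and the
  -- change of order is the permutation `σ` of a tie.
  conflict : ∀ {p q cs ds rs} (tie : Tie p q cs ds rs) →
    (∀ {k} (f : Fin k → V) → (∀ i j → f i ≡ f j → i ≡ j) → (∀ i → Tie.Common tie (f i)) → k ≤ 5) →
    ∃ (Tie.Common tie) →
    (∀ {u w} → ¬ Tie.Common tie u → ¬ Tie.Common tie w →
     Star (λ a b → a ~ b × ¬ Tie.Common tie b) u w) → ⊥
  conflict {cs = cs} {ds} tie few common connected
    with unravel (λ v → DecMembership._∈?_ _≟_ v ds) cs | unravel (λ v → DecMembership._∈?_ _≟_ v cs) ds
  ... | w@(record { knots = m ; blocks = as ; points = xs ; weaves = refl ; on = on ; off = off })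
      | w′@(record { knots = m′ ; blocks = bs ; points = ys ; weaves = refl ; on = on′ ; off = off′ })
    -- Injections both ways show that the two cycles are cut equally often.
    = go (ℕ.≤-antisym (Fin.injective⇒≤ {f = proj₁ ∘ ι} ι-injective) (Fin.injective⇒≤ {f = proj₁ ∘ ι′} ι′-injective))
    where
    open Tie tie
    xs-injective = points-injective as xs (tail unique₁)
    ys-injective = points-injective bs ys (tail unique₂)

    ι : ∀ j → ∃ λ i → lookup ys j ≡ lookup xs i
    ι j = points-among w (on′ j) (at-∈ bs ys (inj₁ j) refl)

    ι′ : ∀ i → ∃ λ j → lookup xs i ≡ lookup ys j
    ι′ i = points-among w′ (on i) (at-∈ as xs (inj₁ i) refl)

    ι-injective : ∀ {j j′} → proj₁ (ι j) ≡ proj₁ (ι j′) → j ≡ j′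
    ι-injective {j} {j′} eq = ys-injective j j′
      (trans (proj₂ (ι j)) (trans (cong (lookup xs) eq) (sym (proj₂ (ι j′)))))

    ι′-injective : ∀ {i i′} → proj₁ (ι′ i) ≡ proj₁ (ι′ i′) → i ≡ i′
    ι′-injective {i} {i′} eq = xs-injective i i′
      (trans (proj₂ (ι′ i)) (trans (cong (lookup ys) eq) (sym (proj₂ (ι′ i′)))))

    1≤m : 1 ≤ m
    1≤m with points-among w (proj₁ (proj₂ common)) (proj₂ (proj₂ common))
    ... | i , _ = ℕ.≤-trans (s≤s z≤n) (Fin.toℕ<n i)

    m≤5 : m ≤ 5
    m≤5 = few (lookup xs) xs-injective λ i → at-∈ as xs (inj₁ i) refl , on i

    go : m′ ≡ m → ⊥
    go refl with reindex xs ys ι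
    ... | σ , refl = tie-impossible 1≤m m≤5 σ
      (toList-unique σ λ i j eq → ys-injective i j
        (trans (lookup-map i (lookup xs) σ) (trans (cong (lookup xs) eq) (sym (lookup-map j (lookup xs) σ)))))
      (Realize.tieRealization as bs xs σ tie off′ on connected)

-- Adding an apex joined to every vertex turns longest paths into longest cycles

∈-⋃⁺ : ∀ {n} (xs : List (Fin n)) {x} → x ∈ xs → x Subset.∈ ⋃ (map ⁅_⁆ xs)
∈-⋃⁺ (x ∷ xs) (here refl) = Subset.x∈p∪q⁺ (inj₁ (Subset.x∈⁅x⁆ x))
∈-⋃⁺ (y ∷ xs) (there x∈)  = Subset.x∈p∪q⁺ (inj₂ (∈-⋃⁺ xs x∈))

∈-⋃⁻ : ∀ {n} (xs : List (Fin n)) {x} → x Subset.∈ ⋃ (map ⁅_⁆ xs) → x ∈ xs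
∈-⋃⁻ []       x∈ = contradiction x∈ Subset.∉⊥
∈-⋃⁻ (y ∷ ys) x∈ with Subset.x∈p∪q⁻ ⁅ y ⁆ _ x∈
... | inj₁ x∈y  = here (Subset.x∈⁅y⁆⇒x≡y y x∈y)
... | inj₂ x∈ys = there (∈-⋃⁻ ys x∈ys)

injection-≤ : ∀ {n} k (S : Subset n) (f : Fin k → Fin n) → (∀ i j → f i ≡ f j → i ≡ j) →
              (∀ i → f i Subset.∈ S) → k ≤ ∣ S ∣
injection-≤ zero    S f inj f∈ = z≤n
injection-≤ (suc k) S f inj f∈ = ℕ.≤-<-trans
  (injection-≤ k (S - f zero) (f ∘ suc) (λ i j eq → Fin.suc-injective (inj (suc i) (suc j) eq))
    λ i → Subset.x∈p∧x≢y⇒x∈p-y (f∈ (suc i)) λ eq → case inj (suc i) zero eq of λ ())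
  (Subset.x∈p⇒∣p-x∣<∣p∣ (f∈ zero))

module _ {V : Set} (_~_ : Rel V 0ℓ) where
  open Chains _~_

  rotate : ∀ {u x} xs → Chain u xs u → x ∈ u ∷ xs → ∃ λ ys → Chain x ys x × u ∷ xs ↭ x ∷ ys
  rotate xs c (here refl) = xs , c , ↭-refl
  rotate xs c (there x∈) with ∈-∃++ x∈
  ... | as , bs , refl with chain-split as c
  ...   | c₁ , c₂ = bs ++ _ ∷ as , chain-++ bs c₂ c₁ , ++-comm (_ ∷ as) (_ ∷ bs)

module Cone {n} (G : Graph n) where
  open Graph G using (_~_; ~-sym; ~-irrefl)

  _~⁺_ : Rel (Fin (suc n)) 0ℓ
  zero  ~⁺ zero  = ⊥
  zero  ~⁺ suc _ = Unit
  suc _ ~⁺ zero  = Unit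
  suc a ~⁺ suc b = a ~ b

  ~⁺-sym : Symmetric _~⁺_
  ~⁺-sym {zero}  {suc _} _   = tt
  ~⁺-sym {suc _} {zero}  _   = tt
  ~⁺-sym {suc _} {suc _} a~b = ~-sym a~b

  open Chains _~⁺_

  cone : Path G → List (Fin (suc n))
  cone P = map suc (Path.vertices P)

  cone-length : ∀ P → length (zero ∷ cone P) ≡ suc (suc (pathLength P))
  cone-length P = cong (2 +_) (length-map suc (Path.rest P))

  cone-unique : ∀ P → Unique (zero ∷ cone P)
  cone-unique P = unique-∷ (λ z∈ → case ∈-map⁻ suc z∈ of λ { (_ , _ , ()) })
                           (Unique.map⁺ Fin.suc-injective (Path.distinct P))

  cone-chain : ∀ P → Chain zero (cone P) zero
  cone-chain P = tt , go (Path.linked P)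
    where
    go : ∀ {x xs} → Linked _~_ (x ∷ xs) → Chain (suc x) (map suc xs) zero
    go [-]         = tt
    go (x~y ∷ lnk) = x~y , go lnk

  lower : ∀ (xs : List (Fin (suc n))) → zero ∉ xs → ∃ λ (ys : List (Fin n)) → map suc ys ≡ xs
  lower []           _   = [] , refl
  lower (zero ∷ xs)  0∉  = contradiction (here refl) 0∉
  lower (suc x ∷ xs) 0∉ with lower xs (0∉ ∘ there)
  ... | ys , refl = x ∷ ys , refl

  chain-linked : ∀ {x w} xs → Chain (suc x) (map suc xs) w → Linked _~_ (x ∷ xs)
  chain-linked []       _         = [-]
  chain-linked (y ∷ xs) (x~y , c) = x~y ∷ chain-linked xs c

  apex-free-bound : ∀ (P : Path G) → IsLongest P → ∀ {u w} xs → zero ∉ xs → Chain u xs w → Unique xs →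
                    length xs ≤ suc (pathLength P)
  apex-free-bound P longest xs 0∉xs c u with lower xs 0∉xs
  ... | []     , refl = z≤n
  ... | y ∷ ys , refl = s≤s (subst (_≤ pathLength P) (sym (length-map suc ys)) (longest record
        { start = y ; rest = ys ; distinct = Unique.map⁻ u ; linked = chain-linked ys (proj₂ c) }))

  -- Removing the apex from a cycle through it leaves a path of `G`, with at most `pathLength P + 1`
  -- vertices; the apex adds one.
  cycle-bound : ∀ (P : Path G) → IsLongest P → ∀ {u} xs → Chain u xs u → Unique (u ∷ xs) →
                suc (length xs) ≤ suc (suc (pathLength P))
  cycle-bound P longest {u} xs c uniq with DecMembership._∈?_ Fin._≟_ zero (u ∷ xs)
  ... | yes 0∈ with rotate _~⁺_ xs c 0∈
  ...   | ys , d , p with unique-↭ p uniq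
  ...     | uniq′@(_ ∷ uys) = subst (_≤ suc (suc (pathLength P))) (sym (↭-length p))
            (s≤s (apex-free-bound P longest ys (Unique[x∷xs]⇒x∉xs uniq′) d uys))
  cycle-bound P longest {zero}  xs c uniq | no 0∉ = contradiction (here refl) 0∉
  -- A cycle missing the apex becomes a path of `G` when its closing edge is dropped; the apex
  -- serves as a formal predecessor of its first vertex.
  cycle-bound P longest {suc a} xs c uniq | no 0∉ =
    ℕ.m≤n⇒m≤1+n (apex-free-bound P longest {zero} (suc a ∷ xs) 0∉ (tt , c) uniq)

  uncovered : ∀ (S : Subset n) → ∣ S ∣ < n → ∃ λ w → w Subset.∉ S
  uncovered S ∣S∣<n = Fin.¬∀⟶∃¬ n (Subset._∈ S) (Subset._∈? S) λ all →
    ℕ.<-irrefl refl (ℕ.≤-<-trans (subst (_≤ ∣ S ∣) (Subset.∣⊤∣≡n n) (Subset.p⊆q⇒∣p∣≤∣q∣ {p = ⊤} λ {x} _ → all x)) ∣S∣<n)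

  -- If the path had fewer than five vertices, deleting all of them but `start` would leave the
  -- graph connected and some vertex off the path. The first edge of a walk from `start` to it would
  -- prolong the path.
  longest-large : IsConnected 5 G → ∀ (P : Path G) → IsLongest P → 5 ≤ ∣ V⟨ P ⟩ ∣
  longest-large (5<n , connected) P longest = ℕ.≮⇒≥ λ small →
    let w , w∉P = uncovered V⟨ P ⟩ (ℕ.<-trans small 5<n)
        rest<P  = Subset.p⊂q⇒∣p∣<∣q∣ (rest⊆P , start , ∈-⋃⁺ vertices (here refl) , start∉rest)
    in extend w∉P (connected (⋃ (map ⁅_⁆ rest)) (ℕ.<-trans rest<P small)
                             (start , start∉rest) (w , w∉P ∘ rest⊆P))
    where
    open Path P

    start∉rest : start Subset.∉ ⋃ (map ⁅_⁆ rest)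
    start∉rest start∈ = Unique[x∷xs]⇒x∉xs distinct (∈-⋃⁻ rest start∈)

    rest⊆P : ∀ {x} → x Subset.∈ ⋃ (map ⁅_⁆ rest) → x Subset.∈ V⟨ P ⟩
    rest⊆P x∈ = ∈-⋃⁺ vertices (there (∈-⋃⁻ rest x∈))

    extend : ∀ {w} → proj₁ w Subset.∉ V⟨ P ⟩ → Star (G − ⋃ (map ⁅_⁆ rest)) (start , start∉rest) w → ⊥
    extend w∉P ε = w∉P (∈-⋃⁺ vertices (here refl))
    extend w∉P (_◅_ {j = y , y∉rest} start~y _) = ℕ.<-irrefl refl (longest record
      { start    = y
      ; rest     = vertices
      ; distinct = unique-∷ (λ { (here refl) → ~-irrefl refl start~y ; (there y∈) → y∉rest (∈-⋃⁺ rest y∈) }) distinct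
      ; linked   = ~-sym start~y ∷ linked })

  -- Two longest paths with few common vertices.

  module Intersection (conn : IsConnected 5 G) (P Q : Path G) (longestP : IsLongest P) (longestQ : IsLongest Q)
                      (small : ∣ V⟨ P ⟩ ∩ V⟨ Q ⟩ ∣ < 5) where

    S : Subset n
    S = V⟨ P ⟩ ∩ V⟨ Q ⟩

    P⁺ Q⁺ : List (Fin (suc n))
    P⁺ = zero ∷ cone P
    Q⁺ = zero ∷ cone Q

    _∈?_ = DecMembership._∈?_ {A = Fin (suc n)} Fin._≟_

    Shared : Fin (suc n) → Set
    Shared v = v ∈ P⁺ × v ∈ Q⁺

    suc-∈⁻ : ∀ {a} (R : Path G) → suc a ∈ zero ∷ cone R → a Subset.∈ V⟨ R ⟩
    suc-∈⁻ R (there a∈) with ∈-map⁻ suc a∈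
    ... | _ , a∈R , refl = ∈-⋃⁺ (Path.vertices R) a∈R

    suc-∈⁺ : ∀ {a} (R : Path G) → a Subset.∈ V⟨ R ⟩ → suc a ∈ zero ∷ cone R
    suc-∈⁺ R a∈ = there (∈-map⁺ suc (∈-⋃⁻ (Path.vertices R) a∈))

    shared⇒∈S : ∀ {a} → Shared (suc a) → a Subset.∈ S
    shared⇒∈S (a∈P , a∈Q) = Subset.x∈p∩q⁺ (suc-∈⁻ P a∈P , suc-∈⁻ Q a∈Q)

    ∈S⇒shared : ∀ {a} → a Subset.∈ S → Shared (suc a)
    ∈S⇒shared a∈S = let a∈P , a∈Q = Subset.x∈p∩q⁻ V⟨ P ⟩ V⟨ Q ⟩ a∈S in suc-∈⁺ P a∈P , suc-∈⁺ Q a∈Q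

    few-shared : ∀ {k} (f : Fin k → Fin (suc n)) → (∀ i j → f i ≡ f j → i ≡ j) → (∀ i → Shared (f i)) → k ≤ 5
    -- Here `inside` stands for the apex, so the set has `suc ∣ S ∣` members, and `small` says that
    -- this is at most five.
    few-shared f inj shared = ℕ.≤-trans (injection-≤ _ (inside Vec.∷ S) f inj f∈) small
      where
      f∈ : ∀ i → f i Subset.∈ inside Vec.∷ S
      f∈ i with f i | shared i
      ... | zero  | _  = Vec.here
      ... | suc a | sh = Vec.there (shared⇒∈S sh)

    -- The apex is shared, so both ends lie in `G`, where fewer than five vertices are deleted.
    shared-connected : ∀ {u w} → ¬ Shared u → ¬ Shared w → Star (λ a b → a ~⁺ b × ¬ Shared b) u w
    shared-connected {zero}          ¬u _  = contradiction (here refl , here refl) ¬u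
    shared-connected {suc _} {zero}  _  ¬w = contradiction (here refl , here refl) ¬w
    shared-connected {suc a} {suc b} ¬u ¬w =
      Star.gmap (suc ∘ proj₁) (λ { {_} {_ , y∉S} x~y → x~y , y∉S ∘ shared⇒∈S })
        (proj₂ conn S small (a , ¬u ∘ ∈S⇒shared) (b , ¬w ∘ ∈S⇒shared))

    -- Otherwise `R` would lie within `S`, which is too small for a longest path.
    escapes : ∀ (R T : Path G) → IsLongest R → (∀ {a} → a Subset.∈ V⟨ R ⟩ → a Subset.∈ V⟨ T ⟩ → a Subset.∈ S) →
              ∃ λ v → v ∈ zero ∷ cone R × v ∉ zero ∷ cone T
    escapes R T longest ∩⊆S with All.all? (_∈? (zero ∷ cone T)) (zero ∷ cone R)
    ... | no ¬all = find (¬All⇒Any¬ (_∈? (zero ∷ cone T)) _ ¬all)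
    ... | yes all = contradiction (longest-large conn R longest) (ℕ.<⇒≱ (ℕ.≤-<-trans
      (Subset.p⊆q⇒∣p∣≤∣q∣ λ a∈R → ∩⊆S a∈R (suc-∈⁻ T (All.lookup all (suc-∈⁺ R a∈R)))) small))

    classify : ∀ v → ¬ Shared v → (v ∈ P⁺ × v ∉ Q⁺) ⊎ (v ∈ Q⁺ × v ∉ P⁺) ⊎ (v ∉ P⁺ × v ∉ Q⁺)
    classify v ¬shared with v ∈? P⁺ | v ∈? Q⁺
    ... | yes v∈P | yes v∈Q = contradiction (v∈P , v∈Q) ¬shared
    ... | yes v∈P | no  v∉Q = inj₁ (v∈P , v∉Q)
    ... | no  v∉P | yes v∈Q = inj₂ (inj₁ (v∈Q , v∉P))
    ... | no  v∉P | no  v∉Q = inj₂ (inj₂ (v∉P , v∉Q))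

    link : Bridge Fin._≟_ classify (λ (v∈P , _) (_ , v∉P) → v∉P v∈P)
    link with escapes P Q longestP (λ a∈P a∈Q → Subset.x∈p∩q⁺ (a∈P , a∈Q))
            | escapes Q P longestQ (λ a∈Q a∈P → Subset.x∈p∩q⁺ (a∈P , a∈Q))
    ... | u , u∈P , u∉Q | w , w∈Q , w∉P =
      bridge Fin._≟_ classify (λ (v∈P , _) (_ , v∉P) → v∉P v∈P) (u∈P , u∉Q) (w∈Q , w∉P)
        (shared-connected (u∉Q ∘ proj₂) (w∉P ∘ proj₁))

    impossible : ⊥
    impossible with link
    ... | p , q , rs , (p∈P , p∉Q) , (q∈Q , q∉P) , cᵣ , uᵣ , rs-outside
      -- Both cycles are rotated to start at the ends of the connecting path. These ends are not
      -- shared, so rebasing keeps all shared vertices among `cs` and `ds`.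
      with rotate _~⁺_ (cone P) (cone-chain P) p∈P | rotate _~⁺_ (cone Q) (cone-chain Q) q∈Q
    ... | cs , c₁ , perm₁ | ds , c₂ , perm₂ = conflict tie
      (λ f inj com → few-shared f inj (common⇒shared ∘ com))
      (zero , shared⇒common (here refl , here refl))
      (λ ¬u ¬w → Star.map (λ (a~b , ¬sh) → a~b , ¬sh ∘ common⇒shared)
                   (shared-connected (¬u ∘ shared⇒common) (¬w ∘ shared⇒common)))
      where
      open BoundedCycles Fin._≟_ _~⁺_ (λ {a} → ~⁺-sym {a}) (suc (suc (pathLength P))) (cycle-bound P longestP)

      tie : Tie p q cs ds rs
      tie = record
        { chain₁ = c₁ ; chain₂ = c₂ ; chainᵣ = cᵣ
        ; unique₁ = unique-↭ perm₁ (cone-unique P)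
        ; unique₂ = unique-↭ perm₂ (cone-unique Q)
        ; uniqueᵣ = uᵣ
        ; length₁ = trans (sym (↭-length perm₁)) (cone-length P)
        ; length₂ = trans (sym (↭-length perm₂)) (trans (cone-length Q)
            (cong (2 +_) (ℕ.≤-antisym (longestP Q) (longestQ P))))
        ; avoids₁ = λ v∈ v∈′ → proj₁ (rs-outside v∈) (∈-resp-↭ (↭-sym perm₁) v∈′)
        ; avoids₂ = λ v∈ v∈′ → proj₂ (rs-outside v∈) (∈-resp-↭ (↭-sym perm₂) v∈′)
        ; p∉₂ = p∉Q ∘ ∈-resp-↭ (↭-sym perm₂)
        ; q∉₁ = q∉P ∘ ∈-resp-↭ (↭-sym perm₁)
        }

      common⇒shared : ∀ {v} → Tie.Common tie v → Shared v
      common⇒shared (v∈cs , v∈ds) = ∈-resp-↭ (↭-sym perm₁) (there v∈cs) , ∈-resp-↭ (↭-sym perm₂) (there v∈ds)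

      shared⇒common : ∀ {v} → Shared v → Tie.Common tie v
      shared⇒common (v∈P , v∈Q) with ∈-resp-↭ perm₁ v∈P | ∈-resp-↭ perm₂ v∈Q
      ... | here refl | _         = contradiction v∈Q p∉Q
      ... | there _   | here refl = contradiction v∈P q∉P
      ... | there v∈cs | there v∈ds = v∈cs , v∈ds

theorem1p3 : ∀ (n : ℕ) (G : Graph n) → IsConnected 5 G →
    ∀ (P Q : Path G) → IsLongest P → IsLongest Q → ∣ V⟨ P ⟩ ∩ V⟨ Q ⟩ ∣ ≥ 5
theorem1p3 n G conn P Q longestP longestQ =
  ℕ.≮⇒≥ (Cone.Intersection.impossible G conn P Q longestP longestQ)
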